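{- The decision problem 5th MIL$_{MIZ}$ is solvable in polynomial time.
   Context: Let $G=\langle V,E\rangle$ be a finite directed acyclic graph (DAG). A topological sorting of $G$ is a bijection $\tau:V\to\{1,\dots,|V|\}$ with $\tau(u)<\tau(v)$ for every arc $\langle u,v\rangle\in E$. 5th MIL$_{MIZ}$: Instance: a DAG $G=\langle V,E\rangle$, a subset $E_1\subseteq E$, and a positive integer $K\le|V|$. Question: is there a topological sorting $\tau$ of $G$ such that the set $\{v\in V:\exists u\in V\ (\langle v,u\rangle\in E_1\wedge(\tau(u)-\tau(v)>1\ \vee\ \exists w\in V\ \langle v,w\rangle\in E\setminus E_1))\}$ has size at most $K$? -}

module Defs where

open import Data.Bool.Base using (Bool; true; false; T; not; _∧_)
open import Data.Bool.Properties using (T?)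
open import Data.Fin.Base using (Fin; toℕ)
open import Data.Fin.Properties using (any?)
open import Data.List.Base using (List; []; _∷_; _++_; map; length; replicate; concatMap; allFin)
open import Data.Nat.Base using (ℕ; zero; suc; _+_; _*_; _∸_; _≤_; _<_; _>_)
import Data.Nat.Properties as ℕ
open import Data.Product.Base using (Σ-syntax; ∃-syntax; _×_; _,_; proj₁)
open import Data.Sum.Base using (_⊎_)
open import Data.Vec.Base as Vec using (Vec)
open import Function.Bundles using (_⤖_; Bijection)
open import Relation.Binary.Construct.Closure.Transitive using (TransClosure)
open import Relation.Binary.PropositionalEquality.Core using (_≡_)
open import Relation.Nullary using (¬_; Dec)
open import Relation.Nullary.Decidable using (_×-dec_; _⊎-dec_)

data Symbol (g : ℕ) : Set where
  blank : Symbol g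
  bit   : Bool → Symbol g
  aux   : Fin g → Symbol g

data Move : Set where
  left stay right : Move

-- Two-way infinite tape.  Both lists are read outwards from the head, and
-- all cells beyond their ends are blank.
record Tape (g : ℕ) : Set where
  constructor tape
  field
    before : List (Symbol g)
    head   : Symbol g
    after  : List (Symbol g)

open Tape public using (head)

move : ∀ {g} → Move → Tape g → Tape g
move stay  t                      = t
move left  (tape []       a rs)   = tape [] blank (a ∷ rs)
move left  (tape (l ∷ ls) a rs)   = tape ls l (a ∷ rs)
move right (tape ls a [])         = tape (a ∷ ls) blank []
move right (tape ls a (r ∷ rs))   = tape (a ∷ ls) r rs

write : ∀ {g} → Symbol g → Tape g → Tape g
write a (tape ls _ rs) = tape ls a rs

emptyTape : ∀ {g} → Tape g
emptyTape = tape [] blank []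

inputTape : ∀ {g} → List Bool → Tape g
inputTape []       = emptyTape
inputTape (b ∷ bs) = tape [] (bit b) (map bit bs)

data State (q : ℕ) : Set where
  active        : Fin q → State q
  accept reject : State q

-- One read/write input tape and `workTapes` further tapes.
record TuringMachine : Set where
  field
    workTapes  : ℕ
    auxSymbols : ℕ
    states     : ℕ
    start      : State states
    δ          : Fin states → Vec (Symbol auxSymbols) (suc workTapes) →
                 State states × Vec (Symbol auxSymbols × Move) (suc workTapes)

module _ (M : TuringMachine) where
  open TuringMachine M

  Configuration : Set
  Configuration = State states × Vec (Tape auxSymbols) (suc workTapes)

  initial : List Bool → Configuration
  initial w = start , inputTape w Vec.∷ Vec.replicate workTapes emptyTape

  act : Symbol auxSymbols × Move → Tape auxSymbols → Tape auxSymbols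
  act (a , m) t = move m (write a t)

  step : Configuration → Configuration
  step (accept   , ts) = accept , ts
  step (reject   , ts) = reject , ts
  step (active s , ts) =
    let (s′ , as) = δ s (Vec.map head ts) in s′ , Vec.zipWith act as ts

  run : ℕ → Configuration → Configuration
  run zero    c = c
  run (suc t) c = run t (step c)

  -- Halting configurations are fixed by `step`, so being in a halting state
  -- after exactly t steps means having halted within t steps.
  AcceptsWithin RejectsWithin : ℕ → List Bool → Set
  AcceptsWithin t w = proj₁ (run t (initial w)) ≡ accept
  RejectsWithin t w = proj₁ (run t (initial w)) ≡ reject

-- Coefficients in ℕ, constant term first.
Polynomial : Set
Polynomial = List ℕ

eval : Polynomial → ℕ → ℕ
eval []      x = 0
eval (a ∷ p) x = a + x * eval p x

Language : Set₁
Language = List Bool → Set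

DecidesInTime : TuringMachine → Language → (ℕ → ℕ) → Set
DecidesInTime M L f = ∀ w →
  (AcceptsWithin M (f (length w)) w × L w) ⊎
  (RejectsWithin M (f (length w)) w × ¬ L w)

record DecisionProblem : Set₁ where
  field
    Instance : Set
    encode   : Instance → List Bool
    Yes      : Instance → Set

-- Strings that do not encode an instance are outside the language, so a
-- machine deciding it has to recognise and reject them.
language : DecisionProblem → Language
language Π w = Σ[ I ∈ Instance ] (encode I ≡ w × Yes I)
  where open DecisionProblem Π

SolvableInPolynomialTime : DecisionProblem → Set
SolvableInPolynomialTime Π =
  Σ[ M ∈ TuringMachine ] Σ[ p ∈ Polynomial ] DecidesInTime M (language Π) (eval p)

-- Arc sets on the vertex set Fin n, as adjacency matrices.
Arcs : ℕ → Set
Arcs n = Fin n → Fin n → Bool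

_∋⟨_,_⟩ : ∀ {n} → Arcs n → Fin n → Fin n → Set
E ∋⟨ u , v ⟩ = T (E u v)

_∖_ : ∀ {n} → Arcs n → Arcs n → Arcs n
(E ∖ F) u v = E u v ∧ not (F u v)

_⊆_ : ∀ {n} → Arcs n → Arcs n → Set
E ⊆ F = ∀ u v → E ∋⟨ u , v ⟩ → F ∋⟨ u , v ⟩

Acyclic : ∀ {n} → Arcs n → Set
Acyclic E = ∀ v → ¬ TransClosure (E ∋⟨_,_⟩) v v

-- Positions are 1, …, n.
position : ∀ {n} → Fin n ⤖ Fin n → Fin n → ℕ
position τ v = suc (toℕ (Bijection.to τ v))

IsTopologicalSorting : ∀ {n} → Arcs n → Fin n ⤖ Fin n → Set
IsTopologicalSorting E τ = ∀ u v → E ∋⟨ u , v ⟩ → position τ u < position τ v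

-- Truncated subtraction is harmless here: a negative difference is not > 1.
Counted : ∀ {n} → Arcs n → Arcs n → Fin n ⤖ Fin n → Fin n → Set
Counted E E₁ τ v = ∃[ u ] (E₁ ∋⟨ v , u ⟩ ×
  (position τ u ∸ position τ v > 1 ⊎ (∃[ w ] (E ∖ E₁) ∋⟨ v , w ⟩)))

counted? : ∀ {n} (E E₁ : Arcs n) (τ : Fin n ⤖ Fin n) v → Dec (Counted E E₁ τ v)
counted? E E₁ τ v = any? λ u → T? (E₁ v u) ×-dec
  ((1 ℕ.<? (position τ u ∸ position τ v)) ⊎-dec any? (λ w → T? ((E ∖ E₁) v w)))

record MILInstance : Set where
  field
    n       : ℕ
    E       : Arcs n
    acyclic : Acyclic E
    E₁      : Arcs n
    E₁⊆E    : E₁ ⊆ E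
    K       : ℕ
    K>0     : K > 0
    K≤n     : K ≤ n

-- 1ⁿ 0 1ᴷ 0 followed by the two adjacency matrices, interleaved entry by
-- entry in row-major order.  As K ≤ n and the matrices already take 2n² bits,
-- writing n and K in unary changes the length only polynomially.
encodeMIL : MILInstance → List Bool
encodeMIL I =
  replicate n true ++ false ∷ replicate K true ++ false ∷
  concatMap (λ u → concatMap (λ v → E u v ∷ E₁ u v ∷ []) (allFin n)) (allFin n)
  where open MILInstance I

5th-MIL-MIZ : DecisionProblem
5th-MIL-MIZ = record
  { Instance = MILInstance
  ; encode   = encodeMIL
  ; Yes      = λ I → let open MILInstance I in
      Σ[ τ ∈ Fin n ⤖ Fin n ] (IsTopologicalSorting E τ ×
        Vec.count (counted? E E₁ τ) (Vec.allFin n) ≤ K)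
  }

{-# OPTIONS --safe #-}
module Submission where

open import Defs
open import Data.Bool.Base using (Bool; true; false; T; not; _∧_; _∨_; if_then_else_)
open import Data.Bool.Properties using (T?; T-∧; T-∨)
open import Data.Empty using (⊥-elim)
open import Data.Fin.Base as F using (Fin; zero; suc; toℕ; combine; remQuot; punchOut)
open import Data.Fin.Induction using (<-wellFounded)
open import Data.Fin.Properties as F using (remQuot-combine; suc-injective; toℕ-injective; toℕ<n)
open import Data.List.Base using
  (List; []; _∷_; _++_; map; length; replicate; concatMap; tabulate; allFin)
open import Data.List.Properties using (length-++; length-replicate)
open import Data.Nat.Base using (ℕ; zero; suc; _+_; _*_; _∸_; _≤_; _<_; _<ᵇ_; z≤n; s≤s)
open import Data.Nat.Induction using () renaming (<-wellFounded to ℕ-<-wellFounded)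
import Data.Nat.Properties as ℕ
open import Data.Nat.Tactic.RingSolver using (solve-∀)
open import Data.Product.Base using (Σ-syntax; ∃-syntax; _×_; _,_; proj₁; proj₂)
open import Data.Sum.Base using (_⊎_; inj₁; inj₂)
open import Data.Vec.Base as Vec using (Vec; []; _∷_)
open import Function.Base using (_∘_; id; case_of_)
open import Function.Bundles using (_⤖_; mk⤖; Bijection; Equivalence)
open import Induction.WellFounded using (Acc; acc)
open import Relation.Binary.Construct.Closure.Transitive using (TransClosure; [_]; _∷_)
open import Relation.Binary.Definitions using (tri<; tri≈; tri>)
open import Relation.Binary.PropositionalEquality
open import Relation.Nullary using (¬_; Dec; yes; no; does)
open import Relation.Nullary.Decidable using (_×-dec_)

-- A vertex with an arc in E₁ escapes being counted only if its sole arc goes to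
-- the next vertex of the sorting, and no two vertices can share a next vertex.
-- So at most one vertex is saved per target of such a sole arc.  This is
-- attained: choose for every target the first of its candidates and glue it to
-- the target.  The glued chains have outgoing arcs only at their last vertices,
-- hence can be moved together in a topological sorting.  The minimum is thus
-- the number of "bad" vertices, those with an arc in E₁ that are not glued, and
-- it is found by two passes over the adjacency matrices.
--
-- Acyclicity is tested by computing, for t = 1, 2, …, n + 1, which vertices
-- start a walk of length t; there must eventually be none.

-- Machines with an arbitrary finite set of control states

-- The choice of the glued candidate does not matter for the minimum. A sorting may put another
-- candidate u directly before the target x, but then the glued vertex v of x cannot be there too,
-- so v is counted. Charging u to v is injective, which bounds every sorting from below. Two passes
-- are used because whether a row has a single arc is known only at its end, while the claim on the
-- target must be settled as the arc is read. A matrix with a cycle encodes no instance, so it has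
-- to be rejected; hence the acyclicity test. Its outcome is used once more: the absence of walks of
-- some length yields a height function decreasing along arcs, from which the sorting is built.
-- Non-membership of rejected strings is not shown directly. The machine halts with a verdict on
-- every string and accepts every encoded yes-instance, so determinism keeps rejected strings out of
-- the language. A pass takes quadratic time and there are at most n + 3 of them, so the bound is
-- cubic.

record Finite (A : Set) : Set where
  field
    size        : ℕ
    code        : A → Fin size
    decode      : Fin size → A
    decode-code : ∀ a → decode (code a) ≡ a

open Finite

finite-Fin : ∀ k → Finite (Fin k)
finite-Fin k = record
  { size = k ; code = id ; decode = id ; decode-code = λ _ → refl }

finite-× : ∀ {A B} → Finite A → Finite B → Finite (A × B)
finite-× F G = record
  { size        = size F * size G
  ; code        = λ (a , b) → combine (code F a) (code G b)
  ; decode      = dec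
  ; decode-code = λ (a , b) →
      trans (cong back (remQuot-combine (code F a) (code G b)))
            (cong₂ _,_ (decode-code F a) (decode-code G b))
  }
  where
  back = λ (i , j) → decode F i , decode G j
  dec  = λ x → back (remQuot (size G) x)

finite-retract : ∀ {A B} (f : A → B) (g : B → A) → (∀ a → g (f a) ≡ a) →
                 Finite B → Finite A
finite-retract f g g∘f F = record
  { size        = size F
  ; code        = λ a → code F (f a)
  ; decode      = λ i → g (decode F i)
  ; decode-code = λ a → trans (cong g (decode-code F (f a))) (g∘f a)
  }

finite-Bool : Finite Bool
finite-Bool = finite-retract (λ { false → zero ; true → suc zero })
  (λ { zero → false ; (suc _) → true }) (λ { false → refl ; true → refl }) (finite-Fin 2)

infix 4.5 _▹_ _◃_

-- The head is on the first cell of the second list in ls ▹ rs, and on the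
-- first cell of the first list in ls ◃ rs.
_▹_ _◃_ : ∀ {g} → List (Symbol g) → List (Symbol g) → Tape g
ls ▹ []       = tape ls blank []
ls ▹ (r ∷ rs) = tape ls r rs
[]       ◃ rs = tape [] blank rs
(l ∷ ls) ◃ rs = tape ls l rs

-- Unlike `move`, this splits only on the direction and leaves the lists to `▹` and `◃`, so it
-- computes on tapes whose sides are still variables.
shift : ∀ {g} → Move → Tape g → Tape g
shift left  (tape ls a rs) = ls ◃ (a ∷ rs)
shift stay  t              = t
shift right (tape ls a rs) = (a ∷ ls) ▹ rs

move≡shift : ∀ {g} m (t : Tape g) → move m t ≡ shift m t
move≡shift left  (tape []      _ _)  = refl
move≡shift left  (tape (_ ∷ _) _ _)  = refl
move≡shift stay  _                   = refl
move≡shift right (tape _ _ [])       = refl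
move≡shift right (tape _ _ (_ ∷ _))  = refl

-- Runs of abstract machines and their transfer to Turing machines

data Control (Q : Set) : Set where
  go   : Q → Control Q
  halt : Bool → Control Q

module Machine {Q : Set} (finite : Finite Q) {k g : ℕ} (q₀ : Q)
  (δ : Q → Vec (Symbol g) (suc k) → Control Q × Vec (Symbol g × Move) (suc k)) where

  Config : Set
  Config = Control Q × Vec (Tape g) (suc k)

  perform : Symbol g × Move → Tape g → Tape g
  perform (a , m) t = shift m (write a t)

  next : Config → Config
  next (halt b , ts) = halt b , ts
  next (go q   , ts) =
    proj₁ (δ q (Vec.map head ts)) , Vec.zipWith perform (proj₂ (δ q (Vec.map head ts))) ts

  runs : ℕ → Config → Config
  runs zero    c = c
  runs (suc t) c = runs t (next c)

  -- A record rather than the bare equation, so that unification recovers configurations and times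
  -- instead of unfolding `runs`.
  record _⟶[_]_ (c : Config) (t : ℕ) (d : Config) : Set where
    constructor reaches
    field reached : runs t c ≡ d

  record _⇓[_]_ (c : Config) (t : ℕ) (b : Bool) : Set where
    constructor halts
    field halted : proj₁ (runs t c) ≡ halt b

  open _⇓[_]_ public

  runs-+ : ∀ s t c → runs (s + t) c ≡ runs t (runs s c)
  runs-+ zero    t c = refl
  runs-+ (suc s) t c = runs-+ s t (next c)

  infixr 4 _then_ _then′_ _thenHalts_

  done : ∀ {c} → c ⟶[ 0 ] c
  done = reaches refl

  tick : ∀ {c t d} → next c ⟶[ t ] d → c ⟶[ suc t ] d
  tick (reaches p) = reaches p

  tickHalts : ∀ {c t b} → next c ⇓[ t ] b → c ⇓[ suc t ] b
  tickHalts (halts p) = halts p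

  _then_ : ∀ {s t c d e} → c ⟶[ s ] d → d ⟶[ t ] e → c ⟶[ s + t ] e
  _then_ {s} {t} {c} (reaches p) (reaches q) =
    reaches (trans (runs-+ s t c) (trans (cong (runs t) p) q))

  -- Leftward sweeps meet the tail of an array first and its head last; with the times swapped, the
  -- final step still gives `suc m` definitionally.
  _then′_ : ∀ {s t c d e} → c ⟶[ s ] d → d ⟶[ t ] e → c ⟶[ t + s ] e
  _then′_ {s} {t} {c} {e = e} p q = subst (c ⟶[_] e) (ℕ.+-comm s t) (p then q)

  _thenHalts_ : ∀ {s t c d b} → c ⟶[ s ] d → d ⇓[ t ] b → c ⇓[ s + t ] b
  _thenHalts_ {s} {t} {c} (reaches p) (halts q) =
    halts (trans (cong proj₁ (trans (runs-+ s t c) (cong (runs t) p))) q)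

  stopped : ∀ {t b ts} → (halt b , ts) ⇓[ t ] b
  stopped {zero}  = halts refl
  stopped {suc t} = tickHalts (stopped {t})

  halts-+ : ∀ s t c {b} → c ⇓[ s ] b → c ⇓[ s + t ] b
  halts-+ s t c (halts h) with runs s c in eq
  halts-+ s t c (halts refl) | halt b , ts = _thenHalts_ {s} (reaches eq) stopped

  halts-≤ : ∀ {s t c b} → s ≤ t → c ⇓[ s ] b → c ⇓[ t ] b
  halts-≤ {s} {t} {c} {b} s≤t h =
    subst (c ⇓[_] b) (ℕ.m+[n∸m]≡n s≤t) (halts-+ s _ c h)

  embed : Control Q → State (size finite)
  embed (go q)       = active (code finite q)
  embed (halt true)  = accept
  embed (halt false) = reject

  machine : TuringMachine
  machine = record
    { workTapes  = k
    ; auxSymbols = g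
    ; states     = size finite
    ; start      = active (code finite q₀)
    ; δ          = λ s as →
        embed (proj₁ (δ (decode finite s) as)) , proj₂ (δ (decode finite s) as)
    }

  zipWith-act : ∀ {j} (as : Vec (Symbol g × Move) j) ts →
    Vec.zipWith (act machine) as ts ≡ Vec.zipWith perform as ts
  zipWith-act []             []       = refl
  zipWith-act ((a , m) ∷ as) (t ∷ ts) = cong₂ _∷_ (move≡shift m (write a t)) (zipWith-act as ts)

  step≡next : ∀ q ts →
    step machine (embed q , ts) ≡ (embed (proj₁ (next (q , ts))) , proj₂ (next (q , ts)))
  step≡next (go q) ts rewrite decode-code finite q = cong₂ _,_ refl (zipWith-act _ ts)
  step≡next (halt true)  ts = refl
  step≡next (halt false) ts = refl

  run≡runs : ∀ t q ts →
    run machine t (embed q , ts) ≡ (embed (proj₁ (runs t (q , ts))) , proj₂ (runs t (q , ts)))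
  run≡runs zero    q ts = refl
  run≡runs (suc t) q ts =
    trans (cong (run machine t) (step≡next q ts)) (run≡runs t _ _)

  onInput : List Bool → Config
  onInput w = go q₀ , inputTape w ∷ Vec.replicate k emptyTape

  halts⇒accepts : ∀ {t w} → onInput w ⇓[ t ] true → AcceptsWithin machine t w
  halts⇒accepts {t} (halts h) = trans (cong proj₁ (run≡runs t (go q₀) _)) (cong embed h)

  halts⇒rejects : ∀ {t w} → onInput w ⇓[ t ] false → RejectsWithin machine t w
  halts⇒rejects {t} (halts h) = trans (cong proj₁ (run≡runs t (go q₀) _)) (cong embed h)

-- A pass leaves in row cell u: for `targets`, whether u has a single arc and
-- that arc is in E₁; for `budget`, whether u is bad, the column cells marking
-- the targets already taken by earlier rows; for `walks`, whether u has an arc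
-- to a marked column.
data Phase : Set where
  setup targets budget walks : Phase

data Q : Set where
  init parseN parseK charge rewindD : Q
  row rewindT forward : Phase → Q
  scan  : Phase → Bool × Bool → Q
  scan′ : Phase → Bool × Bool → Bool → Q
  back  : Phase → Bool → Q
  copy  : Phase → Bool → Q

finite-Phase : Finite Phase
finite-Phase = finite-retract
  (λ { setup → false , false ; targets → false , true
     ; budget → true , false ; walks → true , true })
  (λ { (false , false) → setup ; (false , true) → targets
     ; (true , false) → budget ; (true , true) → walks })
  (λ { setup → refl ; targets → refl ; budget → refl ; walks → refl })
  (finite-× finite-Bool finite-Bool)

-- A tag with room for every possible parameter; being a retract suffices, so parameters that a
-- state lacks are filled arbitrarily.
finite-Q : Finite Q
finite-Q = finite-retract to from from∘to
  (finite-× (finite-Fin 12) (finite-× finite-Phase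
    (finite-× (finite-× finite-Bool finite-Bool) finite-Bool)))
  where
  Code = Fin 12 × Phase × (Bool × Bool) × Bool

  pattern 1+ i = suc i

  to : Q → Code
  to init          = zero , setup , (false , false) , false
  to parseN        = 1+ zero , setup , (false , false) , false
  to parseK        = 1+ (1+ zero) , setup , (false , false) , false
  to charge        = 1+ (1+ (1+ zero)) , setup , (false , false) , false
  to rewindD       = 1+ (1+ (1+ (1+ zero))) , setup , (false , false) , false
  to (row p)       = 1+ (1+ (1+ (1+ (1+ zero)))) , p , (false , false) , false
  to (rewindT p)   = 1+ (1+ (1+ (1+ (1+ (1+ zero))))) , p , (false , false) , false
  to (forward p)   = 1+ (1+ (1+ (1+ (1+ (1+ (1+ zero)))))) , p , (false , false) , false
  to (scan p a)    = 1+ (1+ (1+ (1+ (1+ (1+ (1+ (1+ zero))))))) , p , a , false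
  to (scan′ p a e) = 1+ (1+ (1+ (1+ (1+ (1+ (1+ (1+ (1+ zero)))))))) , p , a , e
  to (back p b)    = 1+ (1+ (1+ (1+ (1+ (1+ (1+ (1+ (1+ (1+ zero))))))))) , p , (false , false) , b
  to (copy p b)    =
    1+ (1+ (1+ (1+ (1+ (1+ (1+ (1+ (1+ (1+ (1+ zero)))))))))) , p , (false , false) , b

  from : Code → Q
  from (zero , _)                                                            = init
  from (1+ zero , _)                                                         = parseN
  from (1+ (1+ zero) , _)                                                    = parseK
  from (1+ (1+ (1+ zero)) , _)                                               = charge
  from (1+ (1+ (1+ (1+ zero))) , _)                                          = rewindD
  from (1+ (1+ (1+ (1+ (1+ zero)))) , p , _)                                 = row p
  from (1+ (1+ (1+ (1+ (1+ (1+ zero))))) , p , _)                            = rewindT p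
  from (1+ (1+ (1+ (1+ (1+ (1+ (1+ zero)))))) , p , _)                       = forward p
  from (1+ (1+ (1+ (1+ (1+ (1+ (1+ (1+ zero))))))) , p , a , _)              = scan p a
  from (1+ (1+ (1+ (1+ (1+ (1+ (1+ (1+ (1+ zero)))))))) , p , a , e)         = scan′ p a e
  from (1+ (1+ (1+ (1+ (1+ (1+ (1+ (1+ (1+ (1+ zero))))))))) , p , _ , b)    = back p b
  from (1+ (1+ (1+ (1+ (1+ (1+ (1+ (1+ (1+ (1+ (1+ _)))))))))) , p , _ , b)  = copy p b

  from∘to : ∀ q → from (to q) ≡ q
  from∘to init          = refl
  from∘to parseN        = refl
  from∘to parseK        = refl
  from∘to charge        = refl
  from∘to rewindD       = refl
  from∘to (row p)       = refl
  from∘to (rewindT p)   = refl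
  from∘to (forward p)   = refl
  from∘to (scan p a)    = refl
  from∘to (scan′ p a e) = refl
  from∘to (back p b)    = refl
  from∘to (copy p b)    = refl

-- The transition table

Sym : Set
Sym = Symbol 0

-- In `targets`, a says that an arc has been read, and b that it is the only one so far and lies in
-- the second matrix; any further arc clears b. In `budget`, an arc of the second matrix makes the
-- row bad unless the row is flagged and the target is still free.
accumulate : Phase → Bool → Bool × Bool → Bool → Bool → Bool → Bool × Bool
accumulate targets r (a , b) e e₁ c = if e then (true , not a ∧ e₁) else (a , b)
accumulate budget  r (a , b) e e₁ c = a , b ∨ (e₁ ∧ not (r ∧ not c))
accumulate _       r (a , b) e e₁ c = a , b ∨ (e ∧ c)

mark : Phase → Bool → Bool → Bool → Bool
mark budget r e₁ c = c ∨ (r ∧ e₁)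
mark _      r e₁ c = c

afterPass : Phase → Q
afterPass budget = charge
afterPass p      = copy p false

transfer : Phase → Bool → Bool
transfer walks r = r
transfer _     r = false

-- In `walks`, an unmarked row tape means that no walk has the current length; the budget has been
-- checked before, so the machine accepts. If walks remain, a counter cell pays for the next round,
-- and a blank there means rejection.
afterCopy : Phase → Bool → Sym → Control Q
afterCopy setup   _     _       = go (row targets)
afterCopy targets _     _       = go (row budget)
afterCopy budget  _     _       = halt false
afterCopy walks   false _       = halt true
afterCopy walks   true  (bit _) = go (row walks)
afterCopy walks   true  _       = halt false

afterCopyMove : Phase → Move
afterCopyMove walks = right
afterCopyMove _     = stay

-- The tapes are, in this order: the input; one cell per column; one cell per
-- row; a unary counter of n cells, used first for K and then for the rounds of
-- the acyclicity test.
δ′ : Q → (t c r d : Sym) → Control Q × (Sym × Move) × (Sym × Move) × (Sym × Move) × (Sym × Move)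
δ′ init t c r d =
  go parseN , (t , stay) , (c , right) , (r , right) , (d , right)
δ′ parseN (bit true) c r d =
  go parseN , (bit true , right) , (bit false , right) , (bit false , right) , (bit false , right)
δ′ parseN (bit false) c r d =
  go parseK , (bit false , right) , (c , stay) , (r , stay) , (d , stay)
δ′ parseK (bit true) c r d =
  go parseK , (bit true , right) , (c , stay) , (r , stay) , (d , left)
-- The counter head is on a cell exactly when 0 < K ≤ n, and K cells then extend from it to the
-- right. The blank written over the last header bit becomes the left border of the matrix.
δ′ parseK (bit false) c r (bit d) =
  go (copy setup false) , (blank , right) , (c , left) , (r , left) , (bit d , stay)
δ′ (row p) t c (bit r) d =
  go (scan p (false , false)) , (t , stay) , (c , stay) , (bit r , stay) , (d , stay)
-- Rows and input end together here; leftover input bits fall through to the rejecting last clause.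
δ′ (row p) blank c r d =
  go (rewindT p) , (blank , left) , (c , stay) , (r , stay) , (d , stay)
δ′ (scan p a) t blank r d =
  go (back p (proj₂ a)) , (t , stay) , (blank , left) , (r , stay) , (d , stay)
δ′ (scan p a) (bit e) c r d =
  go (scan′ p a e) , (bit e , right) , (c , stay) , (r , stay) , (d , stay)
δ′ (scan′ p a e) (bit e₁) (bit c) (bit r) d =
  (if not e ∧ e₁ then halt false else go (scan p (accumulate p r a e e₁ c))) ,
  (bit e₁ , right) , (bit (mark p r e₁ c) , right) , (bit r , stay) , (d , stay)
δ′ (back p b) t (bit c) r d =
  go (back p b) , (t , stay) , (bit c , left) , (r , stay) , (d , stay)
δ′ (back p b) t c r d =
  go (row p) , (t , stay) , (c , right) , (bit b , right) , (d , stay)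
δ′ (rewindT p) (bit b) c r d =
  go (rewindT p) , (bit b , left) , (c , stay) , (r , stay) , (d , stay)
δ′ (rewindT p) t c r d =
  go (forward p) , (t , right) , (c , stay) , (r , stay) , (d , stay)
-- The row head is at the right end after a pass. The column head is brought there too, so that both
-- arrays can be swept leftwards in step.
δ′ (forward p) t (bit c) r d =
  go (forward p) , (t , stay) , (bit c , right) , (r , stay) , (d , stay)
δ′ (forward p) t c r d =
  go (afterPass p) , (t , stay) , (c , left) , (r , left) , (d , stay)
δ′ (copy p any) t (bit c) (bit r) d =
  go (copy p (any ∨ r)) , (t , stay) , (bit (transfer p r) , left) , (bit r , left) , (d , stay)
δ′ (copy p any) t c r d =
  afterCopy p any d , (t , stay) , (c , right) , (r , right) , (d , afterCopyMove p)
δ′ charge t (bit c) (bit false) d =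
  go charge , (t , stay) , (bit true , left) , (bit false , left) , (d , stay)
-- Each bad vertex spends one counter cell; without a cell left, the last clause rejects. The column
-- cells become true because every vertex starts a walk of length 0.
δ′ charge t (bit c) (bit true) (bit d) =
  go charge , (t , stay) , (bit true , left) , (bit true , left) , (bit d , right)
δ′ charge t blank r d =
  go rewindD , (t , stay) , (blank , right) , (r , right) , (d , left)
δ′ rewindD t c r (bit d) =
  go rewindD , (t , stay) , (c , stay) , (r , stay) , (bit d , left)
δ′ rewindD t c r d =
  go (row walks) , (t , stay) , (c , stay) , (r , stay) , (d , right)
δ′ _ t c r d =
  halt false , (t , stay) , (c , stay) , (r , stay) , (d , stay)

δ : Q → Vec Sym 4 → Control Q × Vec (Sym × Move) 4
δ q (t ∷ c ∷ r ∷ d ∷ []) =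
  let (q′ , t′ , c′ , r′ , d′) = δ′ q t c r d in q′ , t′ ∷ c′ ∷ r′ ∷ d′ ∷ []

open Machine finite-Q init δ

-- Arrays and matrices as tape contents, to the right of the head and, reversed, to its left

cells cellsʳ : ∀ {m} → (Fin m → Bool) → List Sym → List Sym
cells {zero}  f z = z
cells {suc m} f z = bit (f zero) ∷ cells (f ∘ suc) z
cellsʳ {zero}  f ls = ls
cellsʳ {suc m} f ls = cellsʳ (f ∘ suc) (bit (f zero) ∷ ls)

entries : ∀ {A : Set} {m} → (Bool → A) → (e e₁ : Fin m → Bool) → List A → List A
entries {m = zero}  f e e₁ z = z
entries {m = suc m} f e e₁ z = f (e zero) ∷ f (e₁ zero) ∷ entries f (e ∘ suc) (e₁ ∘ suc) z

entriesʳ : ∀ {m} → (e e₁ : Fin m → Bool) → List Sym → List Sym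
entriesʳ {zero}  e e₁ ls = ls
entriesʳ {suc m} e e₁ ls = entriesʳ (e ∘ suc) (e₁ ∘ suc) (bit (e₁ zero) ∷ bit (e zero) ∷ ls)

Rows : ℕ → ℕ → Set
Rows m n = Fin m → Fin n → Bool

matrix : ∀ {A : Set} {m n} → (Bool → A) → (E E₁ : Rows m n) → List A → List A
matrix {m = zero}  f E E₁ z = z
matrix {m = suc m} f E E₁ z = entries f (E zero) (E₁ zero) (matrix f (E ∘ suc) (E₁ ∘ suc) z)

matrixʳ : ∀ {m n} → (E E₁ : Rows m n) → List Sym → List Sym
matrixʳ {zero}  E E₁ ls = ls
matrixʳ {suc m} E E₁ ls = matrixʳ (E ∘ suc) (E₁ ∘ suc) (entriesʳ (E zero) (E₁ zero) ls)

pad : ℕ → List Sym → List Sym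
pad zero    ls = ls
pad (suc k) ls = bit false ∷ pad k ls

pad-shift : ∀ k ls → pad k (bit false ∷ ls) ≡ bit false ∷ pad k ls
pad-shift zero    ls = refl
pad-shift (suc k) ls = cong (bit false ∷_) (pad-shift k ls)

pad≡cellsʳ : ∀ k ls → pad k ls ≡ cellsʳ {k} (λ _ → false) ls
pad≡cellsʳ zero    ls = refl
pad≡cellsʳ (suc k) ls = trans (sym (pad-shift k ls)) (pad≡cellsʳ k (bit false ∷ ls))

map-entries : ∀ {m} (e e₁ : Fin m → Bool) z →
  map (bit {0}) (entries id e e₁ z) ≡ entries bit e e₁ (map bit z)
map-entries {zero}  e e₁ z = refl
map-entries {suc m} e e₁ z = cong (λ x → _ ∷ _ ∷ x) (map-entries (e ∘ suc) (e₁ ∘ suc) z)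

map-matrix : ∀ {m n} (E E₁ : Rows m n) z →
  map (bit {0}) (matrix id E E₁ z) ≡ matrix bit E E₁ (map bit z)
map-matrix {zero}  E E₁ z = refl
map-matrix {suc m} E E₁ z = trans (map-entries (E zero) (E₁ zero) _)
  (cong (entries bit (E zero) (E₁ zero)) (map-matrix (E ∘ suc) (E₁ ∘ suc) z))

-- Explicit blanks just outside an array make every traversal restore its tape
-- exactly.
B : List Sym
B = blank ∷ []

-- One pass over the matrix

scanned : ∀ {m} → Phase → Bool → (e e₁ c : Fin m → Bool) → Bool × Bool → Bool × Bool
scanned {zero}  p r e e₁ c a = a
scanned {suc m} p r e e₁ c a =
  scanned p r (e ∘ suc) (e₁ ∘ suc) (c ∘ suc) (accumulate p r a (e zero) (e₁ zero) (c zero))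

newC : ∀ {m n} → Phase → (E E₁ : Rows m n) → (Fin m → Bool) → (Fin n → Bool) → Fin n → Bool
newC {zero}  p E E₁ r c = c
newC {suc m} p E E₁ r c =
  newC p (E ∘ suc) (E₁ ∘ suc) (r ∘ suc) (λ v → mark p (r zero) (E₁ zero v) (c v))

newR : ∀ {m n} → Phase → (E E₁ : Rows m n) → (Fin m → Bool) → (Fin n → Bool) → Fin m → Bool
newR p E E₁ r c zero    = proj₂ (scanned p (r zero) (E zero) (E₁ zero) c (false , false))
newR p E E₁ r c (suc u) =
  newR p (E ∘ suc) (E₁ ∘ suc) (r ∘ suc) (λ v → mark p (r zero) (E₁ zero v) (c v)) u

Valid : ∀ {m} → (e e₁ : Fin m → Bool) → Set
Valid e e₁ = ∀ v → not (e v) ∧ e₁ v ≡ false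

unless : ∀ {b q ts t d} → b ≡ false →
  (go q , ts) ⟶[ t ] d → ((if b then halt false else go q) , ts) ⟶[ t ] d
unless refl p = p

scan-run : ∀ {m} p r a (e e₁ c : Fin m → Bool) → Valid e e₁ → ∀ {ts tz cs cz rs rz d} →
  (go (scan p a) ,
    (ts ▹ entries bit e e₁ tz) ∷ (cs ▹ cells c cz) ∷ tape rs (bit r) rz ∷ d ∷ [])
  ⟶[ m * 2 ]
  (go (scan p (scanned p r e e₁ c a)) ,
    (entriesʳ e e₁ ts ▹ tz) ∷ (cellsʳ (λ v → mark p r (e₁ v) (c v)) cs ▹ cz) ∷
    tape rs (bit r) rz ∷ d ∷ [])
scan-run {zero}  p r a e e₁ c valid = done
scan-run {suc m} p r a e e₁ c valid = tick (tick (unless (valid zero)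
  (scan-run p r _ (e ∘ suc) (e₁ ∘ suc) (c ∘ suc) (valid ∘ suc))))

back-run : ∀ {m} p b (c : Fin m → Bool) {t cs cz r d} →
  (go (back p b) , t ∷ (cellsʳ c cs ◃ cz) ∷ r ∷ d ∷ [])
  ⟶[ m ] (go (back p b) , t ∷ (cs ◃ cells c cz) ∷ r ∷ d ∷ [])
back-run {zero}  p b c = done
back-run {suc m} p b c = back-run p b (c ∘ suc) then′ tick done

rowTime : ℕ → ℕ
rowTime n = 1 + (n * 2 + (1 + (n + 1)))

row-run : ∀ {n} p r (e e₁ c : Fin n → Bool) → Valid e e₁ → ∀ {ts tz rs rz d} →
  (go (row p) ,
    (ts ▹ entries bit e e₁ tz) ∷ (B ▹ cells c B) ∷ tape rs (bit r) rz ∷ d ∷ [])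
  ⟶[ rowTime n ]
  (go (row p) ,
    (entriesʳ e e₁ ts ▹ tz) ∷ (B ▹ cells (λ v → mark p r (e₁ v) (c v)) B) ∷
    (bit (proj₂ (scanned p r e e₁ c (false , false))) ∷ rs ▹ rz) ∷ d ∷ [])
row-run p r e e₁ c valid =
  tick (scan-run p r (false , false) e e₁ c valid then
  tick (back-run p _ (λ v → mark p r (e₁ v) (c v)) then
  tick done))

rows-run : ∀ {m n} p (E E₁ : Rows m n) r c → (∀ u → Valid (E u) (E₁ u)) → ∀ {ts tz rs rz d} →
  (go (row p) ,
    (ts ▹ matrix bit E E₁ tz) ∷ (B ▹ cells c B) ∷ (rs ▹ cells r rz) ∷ d ∷ [])
  ⟶[ m * rowTime n ]
  (go (row p) ,
    (matrixʳ E E₁ ts ▹ tz) ∷ (B ▹ cells (newC p E E₁ r c) B) ∷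
    (cellsʳ (newR p E E₁ r c) rs ▹ rz) ∷ d ∷ [])
rows-run {zero}  p E E₁ r c valid = done
rows-run {suc m} p E E₁ r c valid =
  row-run p (r zero) (E zero) (E₁ zero) c (valid zero) then
  rows-run p (E ∘ suc) (E₁ ∘ suc) (r ∘ suc) _ (valid ∘ suc)

rewindT-entries : ∀ {m} p (e e₁ : Fin m → Bool) {ts tz c r d} →
  (go (rewindT p) , (entriesʳ e e₁ ts ◃ tz) ∷ c ∷ r ∷ d ∷ [])
  ⟶[ m * 2 ] (go (rewindT p) , (ts ◃ entries bit e e₁ tz) ∷ c ∷ r ∷ d ∷ [])
rewindT-entries {zero}  p e e₁ = done
rewindT-entries {suc m} p e e₁ =
  rewindT-entries p (e ∘ suc) (e₁ ∘ suc) then′ tick (tick done)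

rewindT-run : ∀ {m n} p (E E₁ : Rows m n) {ts tz c r d} →
  (go (rewindT p) , (matrixʳ E E₁ ts ◃ tz) ∷ c ∷ r ∷ d ∷ [])
  ⟶[ m * (n * 2) ] (go (rewindT p) , (ts ◃ matrix bit E E₁ tz) ∷ c ∷ r ∷ d ∷ [])
rewindT-run {zero}  p E E₁ = done
rewindT-run {suc m} p E E₁ =
  rewindT-run p (E ∘ suc) (E₁ ∘ suc) then′ rewindT-entries p (E zero) (E₁ zero)

forward-run : ∀ {m} p (c : Fin m → Bool) {t cs cz r d} →
  (go (forward p) , t ∷ (cs ▹ cells c cz) ∷ r ∷ d ∷ [])
  ⟶[ m ] (go (forward p) , t ∷ (cellsʳ c cs ▹ cz) ∷ r ∷ d ∷ [])
forward-run {zero}  p c = done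
forward-run {suc m} p c = tick (forward-run p (c ∘ suc))

passTime : ℕ → ℕ
passTime n = n * rowTime n + (1 + (n * (n * 2) + (1 + (n + 1))))

-- The input initially has no explicit blank at its right end, hence the
-- hypothesis on tz.
pass-run : ∀ {n} p (E E₁ : Arcs n) r c → (∀ u → Valid (E u) (E₁ u)) → ∀ {g tz d} →
  (∀ ts → (ts ▹ tz) ≡ tape ts blank []) →
  (go (row p) ,
    (blank ∷ g ▹ matrix bit E E₁ tz) ∷ (B ▹ cells c B) ∷ (B ▹ cells r B) ∷ d ∷ [])
  ⟶[ passTime n ]
  (go (afterPass p) ,
    (blank ∷ g ▹ matrix bit E E₁ B) ∷ (cellsʳ (newC p E E₁ r c) B ◃ B) ∷
    (cellsʳ (newR p E E₁ r c) B ◃ B) ∷ d ∷ [])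
pass-run {n} p E E₁ r c valid end =
  rows-run p E E₁ r c valid then
  atEnd (end _)
  (tick (rewindT-run p E E₁ then
  tick (forward-run p (newC p E E₁ r c) then
  tick done)))
  where
  atEnd : ∀ {q t t′ ts s d} → t ≡ t′ → (q , t′ ∷ ts) ⟶[ s ] d → (q , t ∷ ts) ⟶[ s ] d
  atEnd refl p = p

-- Leftward sweeps and the counter

anyCell : ∀ {m} → (Fin m → Bool) → Bool
anyCell {zero}  r = false
anyCell {suc m} r = anyCell (r ∘ suc) ∨ r zero

copy-run : ∀ {m} p (c r : Fin m → Bool) {t cs cz rs rz d} →
  (go (copy p false) , t ∷ (cellsʳ c cs ◃ cz) ∷ (cellsʳ r rs ◃ rz) ∷ d ∷ [])
  ⟶[ m ]
  (go (copy p (anyCell r)) ,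
     t ∷ (cs ◃ cells (transfer p ∘ r) cz) ∷ (rs ◃ cells r rz) ∷ d ∷ [])
copy-run {zero}  p c r = done
copy-run {suc m} p c r = copy-run p (c ∘ suc) (r ∘ suc) then′ tick done

counter : ℕ → ℕ → Tape 0
counter i j = pad i B ▹ pad j B

count : ∀ {m} → (Fin m → Bool) → ℕ
count {zero}  f = 0
count {suc m} f = (if f zero then 1 else 0) + count (f ∘ suc)

-- The sweep runs from the last cell, so the induction hypothesis covers the tail and cell `zero` is
-- charged last. `i′ + j′ ≡ i + j` records that the counter keeps its cells while its head moves, so
-- it can be rewound and used again.
charge-run : ∀ {m} (c r : Fin m → Bool) i j {t cs cz rs rz} →
  (∃[ i′ ] ∃[ j′ ] (count r + j′ ≡ j × i′ + j′ ≡ i + j ×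
    (go charge , t ∷ (cellsʳ c cs ◃ cz) ∷ (cellsʳ r rs ◃ rz) ∷ counter i j ∷ [])
    ⟶[ m ]
    (go charge ,
       t ∷ (cs ◃ cells {m} (λ _ → true) cz) ∷ (rs ◃ cells r rz) ∷ counter i′ j′ ∷ [])))
  ⊎ (j < count r ×
    (go charge , t ∷ (cellsʳ c cs ◃ cz) ∷ (cellsʳ r rs ◃ rz) ∷ counter i j ∷ []) ⇓[ m ] false)
charge-run {zero}  c r i j = inj₁ (i , j , refl , refl , done)
charge-run {suc m} c r i j {t} {cs} {cz} {rs} {rz}
  with charge-run (c ∘ suc) (r ∘ suc) i j {t} {bit (c zero) ∷ cs} {cz} {bit (r zero) ∷ rs} {rz}
... | inj₂ (j<k , h) =
  inj₂ (ℕ.≤-trans j<k (ℕ.m≤n+m _ _) , halts-≤ (ℕ.n≤1+n m) h)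
... | inj₁ (i′ , j′ , refl , eq , run) with r zero | j′
...   | false | k      = inj₁ (i′ , k , refl , eq , (run then′ tick done))
...   | true  | zero   = inj₂
  (s≤s (ℕ.≤-reflexive (ℕ.+-identityʳ _)) ,
   halts-≤ (ℕ.≤-reflexive (ℕ.+-comm m 1)) (run thenHalts tickHalts (stopped {0})))
...   | true  | suc k  = inj₁
  (suc i′ , k , sym (ℕ.+-suc _ k) , trans (sym (ℕ.+-suc i′ k)) eq , (run then′ tick done))

rewindD-run : ∀ i j {k} → i + j ≡ k → ∀ {t c r} →
  (go rewindD , t ∷ c ∷ r ∷ (pad i B ◃ pad j B) ∷ [])
  ⟶[ i ] (go rewindD , t ∷ c ∷ r ∷ (B ◃ pad k B) ∷ [])
rewindD-run zero    j refl = done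
rewindD-run (suc i) j eq   = tick (rewindD-run i (suc j) (trans (ℕ.+-suc i j) eq))

counter-left : ∀ i j → shift left (counter i j) ≡ (pad i B ◃ pad j B)
counter-left i zero    = refl
counter-left i (suc j) = refl

-- Parsing the header

parsingN : List Sym → List Bool → ℕ → Config
parsingN ts bs j = go parseN , (ts ▹ map bit bs) ∷
  (pad j B ▹ []) ∷ (pad j B ▹ []) ∷ (pad j B ▹ []) ∷ []

parseN-run : ∀ n j {k} → n + j ≡ k → ∀ ts bs →
  parsingN ts (replicate n true ++ bs) j
  ⟶[ n ] parsingN (cellsʳ {n} (λ _ → true) ts) bs k
parseN-run zero    j refl ts bs = done
parseN-run (suc n) j eq   ts bs =
  tick (parseN-run n (suc j) (trans (ℕ.+-suc n j) eq) (bit true ∷ ts) bs)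

parsingK : Tape 0 → Tape 0 → List Sym → List Bool → ℕ → ℕ → Config
parsingK c r ts bs i j = go parseK , (ts ▹ map bit bs) ∷ c ∷ r ∷ (pad i B ◃ pad j B) ∷ []

parseK-run : ∀ k i j {l} → k + j ≡ l → ∀ c r ts bs →
  parsingK c r ts (replicate k true ++ bs) (k + i) j
  ⟶[ k ] parsingK c r (cellsʳ {k} (λ _ → true) ts) bs i l
parseK-run zero    i j refl c r ts bs = done
parseK-run (suc k) i j eq   c r ts bs =
  tick (parseK-run k i (suc j) (trans (ℕ.+-suc k j) eq) c r (bit true ∷ ts) bs)

onInput-run : ∀ w → onInput w ⟶[ 1 ] parsingN [] w 0
onInput-run []      = tick done
onInput-run (_ ∷ _) = tick done

header : ℕ → ℕ → List Bool → List Bool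
header n K bs = replicate n true ++ false ∷ replicate K true ++ false ∷ bs

headerTime : ℕ → ℕ → ℕ
headerTime n k = 1 + (n + (1 + (1 + (k + 1))))

parsed : ℕ → ℕ → ℕ → List Sym → List Bool → Config
parsed n i j g bs = go (copy setup false) , (blank ∷ g ▹ map bit bs) ∷
  (pad n B ◃ B) ∷ (pad n B ◃ B) ∷ counter i (suc j) ∷ []

-- Here K = suc k and n = k + suc i, which is the condition 0 < K ≤ n.
header-run : ∀ k i bs → ∃[ g ]
  onInput (header (k + suc i) (suc k) bs)
  ⟶[ headerTime (k + suc i) k ] parsed (k + suc i) i k g bs
header-run k i bs = _ ,
  (onInput-run (header n (suc k) bs) then
  parseN-run n 0 (ℕ.+-identityʳ n) [] _ then
  tick (tick (parseK-run k (suc i) 0 (ℕ.+-identityʳ k) _ _ _ (false ∷ bs) then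
  tick done)))
  where n = k + suc i

setupTime : ℕ → ℕ
setupTime n = n + 1

loaded : ∀ n → Phase → List Sym → List Sym → Tape 0 → Config
loaded n p g tz d = go (row p) , (blank ∷ g ▹ tz) ∷
  (B ▹ cells {n} (λ _ → false) B) ∷ (B ▹ cells {n} (λ _ → false) B) ∷ d ∷ []

setup-run : ∀ n i j g bs →
  parsed n i j g bs ⟶[ setupTime n ] loaded n targets g (map bit bs) (counter i (suc j))
setup-run n i j g bs rewrite pad≡cellsʳ n B =
  copy-run setup (λ _ → false) (λ _ → false) then tick done

-- Rejecting malformed inputs

cons : ∀ {A : Set} {m} → A → (Fin m → A) → Fin (suc m) → A
cons x f zero    = x
cons x f (suc i) = f i

when : ∀ {b q ts t} → b ≡ true → ((if b then halt false else go q) , ts) ⇓[ t ] false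
when refl = stopped

scan-parse : ∀ {m} p r a (c : Fin m → Bool) bs {ts cs cz rs rz d} →
  (∃[ e ] ∃[ e₁ ] ∃[ rest ] (Valid {m} e e₁ × bs ≡ entries id e e₁ rest))
  ⊎ (go (scan p a) ,
      (ts ▹ map bit bs) ∷ (cs ▹ cells c cz) ∷ tape rs (bit r) rz ∷ d ∷ []) ⇓[ m * 2 ] false
scan-parse {zero}  p r a c bs = inj₁ ((λ ()) , (λ ()) , bs , (λ ()) , refl)
scan-parse {suc m} p r a c []       = inj₂ (tickHalts stopped)
scan-parse {suc m} p r a c (e ∷ []) = inj₂ (tickHalts (tickHalts stopped))
scan-parse {suc m} p r a c (e ∷ e₁ ∷ bs) {ts} {cs} {cz} {rs} {rz} {d} with not e ∧ e₁ in eq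
... | true = inj₂ (tickHalts (tickHalts (when eq)))
... | false with scan-parse p r (accumulate p r a e e₁ (c zero)) (c ∘ suc) bs
                   {bit e₁ ∷ bit e ∷ ts} {bit (mark p r e₁ (c zero)) ∷ cs} {cz} {rs} {rz} {d}
...   | inj₁ (f , f₁ , rest , valid , refl) =
  inj₁ (cons e f , cons e₁ f₁ , rest , (λ { zero → eq ; (suc v) → valid v }) , refl)
...   | inj₂ h = inj₂ (tickHalts (tickHalts (unlessHalts eq h)))
  where
  unlessHalts : ∀ {b q ts t v} → b ≡ false →
    (go q , ts) ⇓[ t ] v → ((if b then halt false else go q) , ts) ⇓[ t ] v
  unlessHalts refl p = p

-- A row that parses is followed by `row-run` as on good input, so only the first faulty row has to
-- be examined.
rows-parse : ∀ {m n} p (r : Fin m → Bool) (c : Fin n → Bool) bs {ts rs rz d} →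
  (∃[ E ] ∃[ E₁ ] ∃[ rest ] ((∀ u → Valid (E u) (E₁ u)) × bs ≡ matrix {m = m} {n} id E E₁ rest))
  ⊎ (go (row p) ,
      (ts ▹ map bit bs) ∷ (B ▹ cells c B) ∷ (rs ▹ cells r rz) ∷ d ∷ []) ⇓[ m * rowTime n ] false
rows-parse {zero} p r c bs = inj₁ ((λ ()) , (λ ()) , bs , (λ ()) , refl)
rows-parse {suc m} {n} p r c bs {ts} {rs} {rz} {d}
  with scan-parse p (r zero) (false , false) c bs {ts} {B} {B} {rs} {cells (r ∘ suc) rz} {d}
... | inj₂ h = inj₂ (tickHalts (halts-≤
        (ℕ.≤-trans (ℕ.m≤m+n (n * 2) (1 + (n + 1))) (ℕ.m≤m+n _ (m * rowTime n))) h))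
... | inj₁ (e , e₁ , bs′ , valid , refl)
  with rows-parse p (r ∘ suc) (λ v → mark p (r zero) (e₁ v) (c v)) bs′ {entriesʳ e e₁ ts}
         {bit (proj₂ (scanned p (r zero) e e₁ c (false , false))) ∷ rs} {rz} {d}
...   | inj₁ (E , E₁ , rest , valids , refl) = inj₁
  (cons e E , cons e₁ E₁ , rest , (λ { zero → valid ; (suc u) → valids u }) , refl)
...   | inj₂ h rewrite map-entries e e₁ bs′ =
  inj₂ (row-run p (r zero) e e₁ c valid thenHalts h)

-- The one extra step is the check after the last row, where a surplus bit meets a blank row cell.
matrix-parse : ∀ n bs {g d} →
  (∃[ E ] ∃[ E₁ ] ((∀ u → Valid (E u) (E₁ u)) × bs ≡ matrix {m = n} {n} id E E₁ []))
  ⊎ loaded n targets g (map bit bs) d ⇓[ n * rowTime n + 1 ] false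
matrix-parse n bs {g} {d} with rows-parse {n} {n} targets (λ _ → false) (λ _ → false) bs
                                 {blank ∷ g} {B} {B} {d}
... | inj₂ h = inj₂ (halts-≤ (ℕ.m≤m+n _ 1) h)
... | inj₁ (E , E₁ , [] , valid , eq) = inj₁ (E , E₁ , valid , eq)
... | inj₁ (E , E₁ , b ∷ bs′ , valid , refl) rewrite map-matrix E E₁ (b ∷ bs′) =
  inj₂ (rows-run targets E E₁ _ _ valid thenHalts tickHalts (stopped {0}))

-- Once it has left the array on the left, the counter head sees only blanks, so the bit closing K
-- cannot be accepted.
parseK-overflow : ∀ bs {c r ts zs} →
  (go parseK , (ts ▹ map bit bs) ∷ c ∷ r ∷ tape [] blank zs ∷ []) ⇓[ suc (length bs) ] false
parseK-overflow []           = tickHalts stopped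
parseK-overflow (false ∷ bs) = tickHalts stopped
parseK-overflow (true ∷ bs)  = tickHalts (parseK-overflow bs)

parseK-parse : ∀ bs i j {c r ts} →
  (∃[ k ] ∃[ i′ ] ∃[ rest ] (bs ≡ replicate k true ++ false ∷ rest × i ≡ k + suc i′))
  ⊎ parsingK c r ts bs i j ⇓[ suc (length bs) ] false
parseK-parse []           i       j = inj₂ (tickHalts stopped)
parseK-parse (false ∷ bs) zero    j = inj₂ (tickHalts stopped)
parseK-parse (false ∷ bs) (suc i) j = inj₁ (0 , i , bs , refl , refl)
parseK-parse (true ∷ bs)  zero    j = inj₂ (tickHalts (parseK-overflow bs))
parseK-parse (true ∷ bs)  (suc i) j {c} {r} {ts}
  with parseK-parse bs i (suc j) {c} {r} {bit true ∷ ts}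
... | inj₁ (k , i′ , rest , refl , refl) = inj₁ (suc k , i′ , rest , refl , refl)
... | inj₂ h = inj₂ (tickHalts h)

parseN-parse : ∀ bs j {ts} →
  (∃[ m ] ∃[ k ] ∃[ i ] ∃[ rest ]
    (bs ≡ replicate m true ++ false ∷ replicate (suc k) true ++ false ∷ rest × m + j ≡ k + suc i))
  ⊎ parsingN ts bs j ⇓[ suc (length bs) ] false
parseN-parse []                 j = inj₂ (tickHalts stopped)
parseN-parse (false ∷ [])         j = inj₂ (tickHalts (tickHalts stopped))
-- K = 0: the counter head is still on the blank to the right of its cells.
parseN-parse (false ∷ false ∷ bs) j = inj₂ (tickHalts (tickHalts stopped))
parseN-parse (false ∷ true ∷ bs)  j {ts}
  with parseK-parse bs j 0 {pad j B ▹ []} {pad j B ▹ []} {bit true ∷ bit false ∷ ts}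
... | inj₁ (k , i , rest , refl , eq) = inj₁ (0 , k , i , rest , refl , eq)
... | inj₂ h = inj₂ (tickHalts (tickHalts h))
parseN-parse (true ∷ bs) j {ts} with parseN-parse bs (suc j) {bit true ∷ ts}
... | inj₁ (m , k , i , rest , refl , eq) =
  inj₁ (suc m , k , i , rest , refl , trans (sym (ℕ.+-suc m j)) eq)
... | inj₂ h = inj₂ (tickHalts h)

header-parse : ∀ w →
  (∃[ k ] ∃[ i ] ∃[ bs ] (w ≡ header (k + suc i) (suc k) bs))
  ⊎ onInput w ⇓[ 2 + length w ] false
header-parse w with parseN-parse w 0 {[]}
... | inj₂ h = inj₂ (onInput-run w thenHalts h)
... | inj₁ (m , k , i , rest , refl , eq) = inj₁ (k , i , rest ,
  cong (λ m → header m (suc k) rest) (trans (sym (ℕ.+-identityʳ m)) eq))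

-- The acyclicity test

or : ∀ {m} → Bool → (Fin m → Bool) → Bool
or {zero}  b f = b
or {suc m} b f = or (b ∨ f zero) (f ∘ suc)

or-cong : ∀ {m} b {f g : Fin m → Bool} → (∀ v → f v ≡ g v) → or b f ≡ or b g
or-cong {zero}  b eq = refl
or-cong {suc m} b {g = g} eq rewrite eq zero = or-cong (b ∨ g zero) (eq ∘ suc)

walk : ∀ {n} → Arcs n → ℕ → Fin n → Bool
walk E zero    u = true
walk E (suc t) u = or false (λ v → E u v ∧ walk E t v)

newR-walks : ∀ {m n} (E E₁ : Rows m n) r c u →
  newR walks E E₁ r c u ≡ or false (λ v → E u v ∧ c v)
newR-walks E E₁ r c zero    = scanned-walks (E zero) (E₁ zero) c false
  where
  scanned-walks : ∀ {m} (e e₁ c : Fin m → Bool) b →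
    proj₂ (scanned walks (r zero) e e₁ c (false , b)) ≡ or b (λ v → e v ∧ c v)
  scanned-walks {zero}  e e₁ c b = refl
  scanned-walks {suc m} e e₁ c b = scanned-walks (e ∘ suc) (e₁ ∘ suc) (c ∘ suc) _
newR-walks E E₁ r c (suc u) = newR-walks (E ∘ suc) (E₁ ∘ suc) (r ∘ suc) c u

anyCell-false : ∀ {m} (r : Fin m → Bool) → anyCell r ≡ false → ∀ u → r u ≡ false
anyCell-false {suc m} r eq u with anyCell (r ∘ suc) in eq′
anyCell-false {suc m} r eq zero    | false = eq
anyCell-false {suc m} r eq (suc u) | false = anyCell-false (r ∘ suc) eq′ u

anyCell-true : ∀ {m} (r : Fin m → Bool) → anyCell r ≡ true → ∃[ u ] r u ≡ true
anyCell-true {suc m} r eq with anyCell (r ∘ suc) in eq′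
... | true  = let (u , ru) = anyCell-true (r ∘ suc) eq′ in suc u , ru
... | false = zero , eq

roundTime : ℕ → ℕ
roundTime n = passTime n + (n + 1)

-- Column cells for length t are turned into row cells for length t + 1 and copied back. The counter
-- is consulted only after a round, so j cells allow j + 1 rounds, the last one concerning length
-- `t + suc j`.
walks-run : ∀ {n} (E E₁ : Arcs n) → (∀ u → Valid (E u) (E₁ u)) → ∀ g i j t r c →
  (∀ u → c u ≡ walk E t u) →
  let start = go (row walks) , (blank ∷ g ▹ matrix bit E E₁ B) ∷
        (B ▹ cells c B) ∷ (B ▹ cells r B) ∷ counter i j ∷ [] in
  (start ⇓[ suc j * roundTime n ] true × ∃[ t′ ] (∀ u → walk E t′ u ≡ false))
  ⊎ (start ⇓[ suc j * roundTime n ] false × ∃[ u ] walk E (t + suc j) u ≡ true)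
walks-run {n} E E₁ valid g i j t r c c≡walk = finish j (anyCell r′) refl
  where
  r′ = newR walks E E₁ r c

  r′≡walk : ∀ u → r′ u ≡ walk E (suc t) u
  r′≡walk u = trans (newR-walks E E₁ r c u) (or-cong false λ v → cong (E u v ∧_) (c≡walk v))

  start : ℕ → Config
  start j = go (row walks) , (blank ∷ g ▹ matrix bit E E₁ B) ∷
    (B ▹ cells c B) ∷ (B ▹ cells r B) ∷ counter i j ∷ []

  copied : Bool → ℕ → Config
  copied b j = go (copy walks b) , (blank ∷ g ▹ matrix bit E E₁ B) ∷
    (B ◃ cells r′ B) ∷ (B ◃ cells r′ B) ∷ counter i j ∷ []

  round-run : ∀ j b → anyCell r′ ≡ b → start j ⟶[ passTime n + n ] copied b j
  round-run j b refl =
    pass-run walks E E₁ r c valid (λ _ → refl) then copy-run walks (newC walks E E₁ r c) r′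

  round : ∀ {s c b} → c ⇓[ (passTime n + n) + suc s ] b → c ⇓[ roundTime n + s ] b
  round {s} = halts-≤ (ℕ.≤-reflexive (trans (ℕ.+-assoc (passTime n) n (suc s))
    (trans (cong (passTime n +_) (trans (ℕ.+-suc n s) (cong (_+ s) (ℕ.+-comm 1 n))))
      (sym (ℕ.+-assoc (passTime n) (n + 1) s)))))

  finish : ∀ j b → anyCell r′ ≡ b →
    (start j ⇓[ suc j * roundTime n ] true × ∃[ t′ ] (∀ u → walk E t′ u ≡ false))
    ⊎ (start j ⇓[ suc j * roundTime n ] false × ∃[ u ] walk E (t + suc j) u ≡ true)
  finish j false eq = inj₁
    (round (round-run j false eq thenHalts tickHalts stopped) ,
     suc t , λ u → trans (sym (r′≡walk u)) (anyCell-false r′ eq u))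
  finish zero true eq = inj₂
    (round (round-run zero true eq thenHalts tickHalts stopped) ,
     let (u , ru) = anyCell-true r′ eq in
     u , trans (cong (λ t → walk E t u) (ℕ.+-comm t 1)) (trans (sym (r′≡walk u)) ru))
  finish (suc j) true eq with walks-run E E₁ valid g (suc i) j (suc t) r′ r′ r′≡walk
  ... | inj₁ (h , none) =
    inj₁ (round (round-run (suc j) true eq thenHalts tickHalts h) , none)
  ... | inj₂ (h , u , some) =
    inj₂ (round (round-run (suc j) true eq thenHalts tickHalts h) ,
          u , trans (cong (λ t → walk E t u) (ℕ.+-suc t (suc j))) some)

-- The complete run on a well-formed input

module Spec {n} (E E₁ : Arcs n) where

  unique : Fin n → Bool
  unique = newR targets E E₁ (λ _ → false) (λ _ → false)

  bad : Fin n → Bool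
  bad = newR budget E E₁ unique (λ _ → false)

totalTime : ℕ → ℕ → ℕ
totalTime n k = headerTime n k + (setupTime n + (roundTime n + (roundTime n +
  ((n + 1) + suc n * roundTime n))))

decide-run : ∀ k i (E E₁ : Arcs (k + suc i)) → (∀ u → Valid (E u) (E₁ u)) →
  let n = k + suc i ; w = header n (suc k) (matrix id E E₁ []) ; open Spec E E₁ in
  (onInput w ⇓[ totalTime n k ] true × count bad ≤ suc k × ∃[ t ] (∀ u → walk E t u ≡ false))
  ⊎ (onInput w ⇓[ totalTime n k ] false ×
     (suc k < count bad ⊎ ∃[ u ] walk E (suc n) u ≡ true))
decide-run k i E E₁ valid = conclude
  where
  open Spec E E₁
  n = k + suc i
  w = header n (suc k) (matrix id E E₁ [])
  g = proj₁ (header-run k i (matrix id E E₁ []))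
  X = (n + 1) + suc n * roundTime n

  input : Tape 0
  input = blank ∷ g ▹ matrix bit E E₁ B

  charging : Config
  charging = go charge , input ∷ (cellsʳ (newC budget E E₁ unique (λ _ → false)) B ◃ B) ∷
    (cellsʳ bad B ◃ B) ∷ counter i (suc k) ∷ []

  charged : ℕ → ℕ → Config
  charged i′ j′ = go charge , input ∷ (B ◃ cells {n} (λ _ → true) B) ∷ (B ◃ cells bad B) ∷
    counter i′ j′ ∷ []

  load : onInput w ⟶[ headerTime n k + setupTime n ]
         loaded n targets g (matrix bit E E₁ []) (counter i (suc k))
  load = subst (λ tz → onInput w ⟶[ headerTime n k + setupTime n ]
                       loaded n targets g tz (counter i (suc k)))
    (map-matrix E E₁ [])
    (proj₂ (header-run k i _) then setup-run n i k g _)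

  toCharge : ∀ {b} → charging ⇓[ n + suc X ] b → onInput w ⇓[ totalTime n k ] b
  toCharge h = halts-≤ (ℕ.≤-reflexive time)
    (load thenHalts
     ((pass-run targets E E₁ (λ _ → false) (λ _ → false) valid (λ _ → refl) then
       copy-run targets _ unique then tick done) thenHalts
     (pass-run budget E E₁ unique (λ _ → false) valid (λ _ → refl) thenHalts h)))
    where
    time : (headerTime n k + setupTime n) + (roundTime n + (passTime n + (n + suc X)))
           ≡ totalTime n k
    time = trans (ℕ.+-assoc (headerTime n k) (setupTime n) _)
      (cong (λ t → headerTime n k + (setupTime n + (roundTime n + t)))
        (trans (cong (passTime n +_) (sym (ℕ.+-assoc n 1 X)))
               (sym (ℕ.+-assoc (passTime n) (n + 1) X))))

  fromCharged : ∀ i′ j′ → i′ + j′ ≡ n → ∀ {b} →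
    (go (row walks) , input ∷ (B ▹ cells {n} (λ _ → true) B) ∷ (B ▹ cells bad B) ∷
      counter 0 n ∷ []) ⇓[ suc n * roundTime n ] b →
    charged i′ j′ ⇓[ suc X ] b
  fromCharged i′ j′ eq h = tickHalts (atCounter (counter-left i′ j′)
    (halts-≤ (ℕ.+-monoˡ-≤ _ (ℕ.+-monoˡ-≤ 1 (ℕ.m+n≤o⇒m≤o i′ (ℕ.≤-reflexive eq))))
      ((rewindD-run i′ j′ eq then tick done) thenHalts h)))
    where
    atCounter : ∀ {q t c r d d′ s b} → d ≡ d′ →
      (q , t ∷ c ∷ r ∷ d′ ∷ []) ⇓[ s ] b → (q , t ∷ c ∷ r ∷ d ∷ []) ⇓[ s ] b
    atCounter refl p = p

  i+K≡n : i + suc k ≡ n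
  i+K≡n = trans (ℕ.+-suc i k) (trans (cong suc (ℕ.+-comm i k)) (sym (ℕ.+-suc k i)))

  conclude :
    (onInput w ⇓[ totalTime n k ] true × count bad ≤ suc k × ∃[ t ] (∀ u → walk E t u ≡ false))
    ⊎ (onInput w ⇓[ totalTime n k ] false ×
       (suc k < count bad ⊎ ∃[ u ] walk E (suc n) u ≡ true))
  conclude with charge-run (newC budget E E₁ unique (λ _ → false)) bad i (suc k)
                  {input} {B} {B} {B} {B}
  ... | inj₂ (over , h) = inj₂ (toCharge (halts-≤ (ℕ.m≤m+n n (suc X)) h) , inj₁ over)
  ... | inj₁ (i′ , j′ , spent , kept , run)
    -- Charging has set all columns to true, which is `walk E 0`; the rewound counter offers its n
    -- cells again.
    with walks-run E E₁ valid g 0 n 0 bad (λ _ → true) (λ _ → refl)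
  ...   | inj₁ (h , none) = inj₁
    (toCharge (run thenHalts fromCharged i′ j′ (trans kept i+K≡n) h) ,
     ℕ.m+n≤o⇒m≤o _ (ℕ.≤-reflexive spent) , none)
  ...   | inj₂ (h , some) = inj₂
    (toCharge (run thenHalts fromCharged i′ j′ (trans kept i+K≡n) h) , inj₂ some)
-- Correctness of the passes

or-inv : ∀ {m} b (f : Fin m → Bool) → T (or b f) → T b ⊎ ∃[ v ] T (f v)
or-inv {zero}  b f p = inj₁ p
or-inv {suc m} b f p with or-inv (b ∨ f zero) (f ∘ suc) p
... | inj₂ (v , q) = inj₂ (suc v , q)
... | inj₁ q with Equivalence.to T-∨ q
...   | inj₁ x = inj₁ x
...   | inj₂ y = inj₂ (zero , y)

or-base : ∀ {m} b (f : Fin m → Bool) → T b → T (or b f)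
or-base {zero}  b f p = p
or-base {suc m} b f p = or-base _ (f ∘ suc) (Equivalence.from T-∨ (inj₁ p))

or-intro : ∀ {m} b (f : Fin m → Bool) v → T (f v) → T (or b f)
or-intro b f zero    p = or-base (b ∨ f zero) (f ∘ suc) (Equivalence.from (T-∨ {b}) (inj₂ p))
or-intro b f (suc v) p = or-intro (b ∨ f zero) (f ∘ suc) v p

newR-targets : ∀ {m n} (E E₁ : Rows m n) r c u →
  newR targets E E₁ r c u ≡ proj₂ (scanned targets (r u) (E u) (E₁ u) c (false , false))
newR-targets E E₁ r c zero    = refl
newR-targets E E₁ r c (suc u) = newR-targets (E ∘ suc) (E₁ ∘ suc) (r ∘ suc) c u

module _ (r : Bool) where

  scanned-quiet : ∀ {m} (e e₁ c : Fin m → Bool) a → (∀ v → ¬ T (e v)) →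
    scanned targets r e e₁ c a ≡ a
  scanned-quiet {zero}  e e₁ c a quiet = refl
  scanned-quiet {suc m} e e₁ c a quiet with e zero | quiet zero
  ... | false | _    = scanned-quiet (e ∘ suc) (e₁ ∘ suc) (c ∘ suc) a (quiet ∘ suc)
  ... | true  | ¬e₀ = ⊥-elim (¬e₀ _)

  -- An arc read after another one clears the flag. So the flag was set before this part of the row
  -- and no arc follows, or it was set by the only arc of this part, and then none was read before.
  scanned-unique⁻ : ∀ {m} (e e₁ c : Fin m → Bool) a b →
    T (proj₂ (scanned targets r e e₁ c (a , b))) →
    (T b × (∀ v → ¬ T (e v))) ⊎
    (a ≡ false × ∃[ v ] (T (e₁ v) × (∀ w → T (e w) → w ≡ v)))
  scanned-unique⁻ {zero}  e e₁ c a b p = inj₁ (p , λ ())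
  scanned-unique⁻ {suc m} e e₁ c a b p with e zero in eq
  ... | false with scanned-unique⁻ (e ∘ suc) (e₁ ∘ suc) (c ∘ suc) a b p
  ...   | inj₁ (tb , none) = inj₁ (tb , λ { zero x → subst T eq x ; (suc v) → none v })
  ...   | inj₂ (a≡ , v , e₁v , only) =
    inj₂ (a≡ , suc v , e₁v , λ { zero x → ⊥-elim (subst T eq x)
                               ; (suc w) x → cong suc (only w x) })
  scanned-unique⁻ {suc m} e e₁ c a b p | true
    with scanned-unique⁻ (e ∘ suc) (e₁ ∘ suc) (c ∘ suc) true (not a ∧ e₁ zero) p
  ... | inj₁ (first , none) with a
  ...   | false = inj₂ (refl , zero , first , λ { zero _ → refl ; (suc w) x → ⊥-elim (none w x) })

  scanned-unique⁺ : ∀ {m} (e e₁ c : Fin m → Bool) b v → T (e₁ v) → T (e v) →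
    (∀ w → T (e w) → w ≡ v) → T (proj₂ (scanned targets r e e₁ c (false , b)))
  scanned-unique⁺ e e₁ c b zero e₁v ev only with e zero
  ... | true = subst (T ∘ proj₂)
    (sym (scanned-quiet (e ∘ suc) (e₁ ∘ suc) (c ∘ suc) (true , e₁ zero)
      (λ w x → case only (suc w) x of λ ()))) e₁v
  scanned-unique⁺ e e₁ c b (suc v) e₁v ev only with e zero | only zero
  ... | true  | only₀ = case only₀ _ of λ ()
  ... | false | _ = scanned-unique⁺ (e ∘ suc) (e₁ ∘ suc) (c ∘ suc) b v e₁v ev
    (λ w x → suc-injective (only (suc w) x))

-- The column cells as row u finds them: the initial ones and the targets claimed by flagged rows
-- before u.
marks : ∀ {m n} → (Fin m → Bool) → Rows m n → (Fin n → Bool) → Fin m → Fin n → Bool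
marks s E₁ c zero    v = c v
marks s E₁ c (suc u) v = marks (s ∘ suc) (E₁ ∘ suc) (λ v → c v ∨ (s zero ∧ E₁ zero v)) u v

newR-budget : ∀ {m n} (E E₁ : Rows m n) s c u →
  newR budget E E₁ s c u ≡ or false (λ v → E₁ u v ∧ not (s u ∧ not (marks s E₁ c u v)))
newR-budget E E₁ s c zero    = scanned-budget (E zero) (E₁ zero) c false
  where
  scanned-budget : ∀ {m} (e e₁ c : Fin m → Bool) b →
    proj₂ (scanned budget (s zero) e e₁ c (false , b))
    ≡ or b (λ v → e₁ v ∧ not (s zero ∧ not (c v)))
  scanned-budget {zero}  e e₁ c b = refl
  scanned-budget {suc m} e e₁ c b = scanned-budget (e ∘ suc) (e₁ ∘ suc) (c ∘ suc) _
newR-budget E E₁ s c (suc u) = newR-budget (E ∘ suc) (E₁ ∘ suc) (s ∘ suc) _ u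

marks⁻ : ∀ {m n} (s : Fin m → Bool) (E₁ : Rows m n) c u v → T (marks s E₁ c u v) →
  T (c v) ⊎ ∃[ u′ ] (u′ F.< u × T (s u′) × T (E₁ u′ v))
marks⁻ s E₁ c zero    v p = inj₁ p
marks⁻ s E₁ c (suc u) v p with marks⁻ (s ∘ suc) (E₁ ∘ suc) _ u v p
... | inj₂ (u′ , u′<u , x , y) = inj₂ (suc u′ , s≤s u′<u , x , y)
... | inj₁ q with Equivalence.to T-∨ q
...   | inj₁ x = inj₁ x
...   | inj₂ y = let (x , z) = Equivalence.to T-∧ y in inj₂ (zero , s≤s z≤n , x , z)

marks-base : ∀ {m n} (s : Fin m → Bool) (E₁ : Rows m n) c u v → T (c v) → T (marks s E₁ c u v)
marks-base s E₁ c zero    v p = p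
marks-base s E₁ c (suc u) v p =
  marks-base (s ∘ suc) (E₁ ∘ suc) _ u v (Equivalence.from T-∨ (inj₁ p))

marks⁺ : ∀ {m n} (s : Fin m → Bool) (E₁ : Rows m n) c u v u′ → u′ F.< u →
  T (s u′) → T (E₁ u′ v) → T (marks s E₁ c u v)
marks⁺ s E₁ c (suc u) v zero     _         p q = marks-base (s ∘ suc) (E₁ ∘ suc) _ u v
  (Equivalence.from (T-∨ {c v}) (inj₂ (Equivalence.from T-∧ (p , q))))
marks⁺ s E₁ c (suc u) v (suc u′) (s≤s u′<u) p q =
  marks⁺ (s ∘ suc) (E₁ ∘ suc) _ u v u′ u′<u p q

-- Counting by injections

remove : ∀ {m} → Fin m → (Fin m → Bool) → Fin m → Bool
remove zero    f zero    = false
remove zero    f (suc y) = f (suc y)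
remove (suc x) f zero    = f zero
remove (suc x) f (suc y) = remove x (f ∘ suc) y

remove⁻ : ∀ {m} x (f : Fin m → Bool) y → T (remove x f y) → T (f y) × y ≢ x
remove⁻ zero    f (suc y) p = p , λ ()
remove⁻ (suc x) f zero    p = p , λ ()
remove⁻ (suc x) f (suc y) p =
  let (q , y≢x) = remove⁻ x (f ∘ suc) y p in q , y≢x ∘ suc-injective

remove⁺ : ∀ {m} x (f : Fin m → Bool) y → T (f y) → y ≢ x → T (remove x f y)
remove⁺ zero    f zero    p y≢x = ⊥-elim (y≢x refl)
remove⁺ zero    f (suc y) p y≢x = p
remove⁺ (suc x) f zero    p y≢x = p
remove⁺ (suc x) f (suc y) p y≢x = remove⁺ x (f ∘ suc) y p (y≢x ∘ cong suc)

count-remove : ∀ {m} x (f : Fin m → Bool) → T (f x) → count f ≡ suc (count (remove x f))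
count-remove zero    f p with f zero
... | true = refl
count-remove (suc x) f p =
  trans (cong (k +_) (count-remove x (f ∘ suc) p)) (ℕ.+-suc k _)
  where k = if f zero then 1 else 0

-- Pigeonhole by induction: the image of `zero` is deleted from g, and injectivity keeps the other
-- images away from it. The map takes a membership proof because charging is defined on bad vertices
-- only.
count-injection : ∀ {m n} (f : Fin m → Bool) (g : Fin n → Bool) (φ : ∀ u → T (f u) → Fin n) →
  (∀ u p → T (g (φ u p))) → (∀ u p u′ p′ → φ u p ≡ φ u′ p′ → u ≡ u′) → count f ≤ count g
count-injection {zero}  f g φ φ∈g inj = z≤n
count-injection {suc m} f g φ φ∈g inj with f zero in eq
... | false = count-injection (f ∘ suc) g (φ ∘ suc) (φ∈g ∘ suc)
  (λ u p u′ p′ → suc-injective ∘ inj (suc u) p (suc u′) p′)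
... | true  = subst (suc (count (f ∘ suc)) ≤_) (sym (count-remove x g (φ∈g zero f₀)))
  (s≤s (count-injection (f ∘ suc) (remove x g) (φ ∘ suc)
    (λ u p → remove⁺ x g (φ (suc u) p) (φ∈g (suc u) p)
      (λ same → case inj (suc u) p zero f₀ same of λ ()))
    (λ u p u′ p′ → suc-injective ∘ inj (suc u) p (suc u′) p′)))
  where
  f₀ = subst T (sym eq) _
  x  = φ zero f₀

count-mono : ∀ {m} (f g : Fin m → Bool) → (∀ u → T (f u) → T (g u)) → count f ≤ count g
count-mono f g f⊆g = count-injection f g (λ u _ → u) f⊆g (λ _ _ _ _ → id)

count-all : ∀ m → count {m} (λ _ → true) ≡ m
count-all zero    = refl
count-all (suc m) = cong suc (count-all m)

vec-count : ∀ {A : Set} {P : A → Set} (P? : ∀ x → Dec (P x)) {m} (f : Fin m → A) →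
  Vec.count P? (Vec.tabulate f) ≡ count (λ i → does (P? (f i)))
vec-count P? {zero}  f = refl
vec-count P? {suc m} f with does (P? (f zero))
... | true  = cong suc (vec-count P? (f ∘ suc))
... | false = vec-count P? (f ∘ suc)

-- Links: the arcs along which vertices are glued

T-not⁻ : ∀ {b} → T (not b) → ¬ T b
T-not⁻ {true} ()

T-not⁺ : ∀ {b} → ¬ T b → T (not b)
T-not⁺ {false} _  = _
T-not⁺ {true}  ¬p = ¬p _

module Links {n} (E E₁ : Arcs n) (E₁⊆E : E₁ ⊆ E) where
  open Spec E E₁ public

  good : Fin n → Fin n → Bool
  good u v = unique u ∧ not (marks unique E₁ (λ _ → false) u v)

  Link : Fin n → Fin n → Set
  Link u v = T (E₁ u v) × T (good u v)

  link? : ∀ u v → Dec (Link u v)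
  link? u v = T? (E₁ u v) ×-dec T? (good u v)

  unique⁻ : ∀ u → T (unique u) → ∃[ v ] (T (E₁ u v) × (∀ w → T (E u w) → w ≡ v))
  unique⁻ u p with scanned-unique⁻ false (E u) (E₁ u) _ false false
                     (subst T (newR-targets E E₁ _ _ u) p)
  ... | inj₂ (_ , q) = q

  unique⁺ : ∀ u v → T (E₁ u v) → (∀ w → T (E u w) → w ≡ v) → T (unique u)
  unique⁺ u v p only = subst T (sym (newR-targets E E₁ _ _ u))
    (scanned-unique⁺ false (E u) (E₁ u) _ false v p (E₁⊆E u v p) only)

  bad⁻ : ∀ u → T (bad u) → ∃[ v ] (T (E₁ u v) × ¬ Link u v)
  bad⁻ u p with or-inv false _ (subst T (newR-budget E E₁ unique _ u) p)
  ... | inj₂ (v , q) = let (x , y) = Equivalence.to T-∧ q in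
    v , x , λ (_ , z) → T-not⁻ y z

  bad⁺ : ∀ u v → T (E₁ u v) → ¬ Link u v → T (bad u)
  bad⁺ u v p ¬link = subst T (sym (newR-budget E E₁ unique _ u))
    (or-intro false _ v (Equivalence.from T-∧ (p , T-not⁺ λ g → ¬link (p , g))))

  link-unique : ∀ {u v w} → Link u v → T (E u w) → w ≡ v
  link-unique {u} {v} (p , g) q =
    let (x , _ , only) = unique⁻ u (proj₁ (Equivalence.to T-∧ g)) in
    trans (only _ q) (sym (only v (E₁⊆E u v p)))

  link-¬bad : ∀ {u v} → Link u v → ¬ T (bad u)
  link-¬bad {u} l b = let (w , p , ¬l) = bad⁻ u b in
    ¬l (subst (Link u) (sym (link-unique l (E₁⊆E u w p))) l)

  -- The earlier row has already marked v when the later one is scanned.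
  link-not-later : ∀ {u u′ v} → Link u v → Link u′ v → ¬ u F.< u′
  link-not-later {u} {u′} {v} (p , g) (p′ , g′) u<u′ =
    T-not⁻ (proj₂ (Equivalence.to (T-∧ {unique u′}) g′))
      (marks⁺ unique E₁ _ u′ v u u<u′ (proj₁ (Equivalence.to T-∧ g)) p)

  link-injective : ∀ {u u′ v} → Link u v → Link u′ v → u ≡ u′
  link-injective {u} {u′} l l′ with F.<-cmp u u′
  ... | tri< u<u′ _ _ = ⊥-elim (link-not-later l l′ u<u′)
  ... | tri≈ _ u≡u′ _ = u≡u′
  ... | tri> _ _ u′<u = ⊥-elim (link-not-later l′ l u′<u)

  -- If v is already taken at u, some earlier row with a single arc claimed it; descent on the row
  -- index ends at the first such row.
  link-exists : ∀ u {v} → Acc F._<_ u → T (unique u) → T (E₁ u v) → ∃[ u′ ] Link u′ v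
  link-exists u {v} (acc rec) s p with T? (marks unique E₁ (λ _ → false) u v)
  ... | no ¬m = u , p , Equivalence.from T-∧ (s , T-not⁺ ¬m)
  ... | yes m with marks⁻ unique E₁ _ u v m
  ...   | inj₂ (u′ , u′<u , s′ , p′) = link-exists u′ (rec u′<u) s′ p′

-- Every sorting counts at least as many vertices as there are bad ones

module LowerBound {n} (E E₁ : Arcs n) (E₁⊆E : E₁ ⊆ E)
  (τ : Fin n ⤖ Fin n) (sorted : IsTopologicalSorting E τ) where
  open Links E E₁ E₁⊆E

  position-injective : ∀ {u v} → position τ u ≡ position τ v → u ≡ v
  position-injective eq = Bijection.injective τ (toℕ-injective (ℕ.suc-injective eq))

  adjacent : ∀ {u v} → ¬ Counted E E₁ τ u → T (E₁ u v) → position τ v ≡ suc (position τ u)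
  adjacent {u} {v} ¬counted p = ℕ.≤-antisym
    (ℕ.≤-trans (ℕ.m≤n+m∸n (position τ v) (position τ u))
      (ℕ.≤-trans (ℕ.+-monoʳ-≤ (position τ u) (ℕ.≮⇒≥ λ far → ¬counted (v , p , inj₁ far)))
        (ℕ.≤-reflexive (ℕ.+-comm (position τ u) 1))))
    (sorted u v (E₁⊆E u v p))

  -- Arcs in `E₁` from an uncounted vertex all lead to the next position, hence to one vertex, and
  -- an arc outside `E₁` would make it counted.
  uncounted-unique : ∀ {u v} → ¬ Counted E E₁ τ u → T (E₁ u v) → T (unique u)
  uncounted-unique {u} {v} ¬counted p = unique⁺ u v p only
    where
    only : ∀ w → T (E u w) → w ≡ v
    only w q with T? (E₁ u w)
    ... | yes p′ = position-injective (trans (adjacent ¬counted p′) (sym (adjacent ¬counted p)))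
    ... | no ¬p′ = ⊥-elim (¬counted
      (v , p , inj₂ (w , Equivalence.from T-∧ (q , T-not⁺ ¬p′))))

  data Charged (u v : Fin n) : Set where
    itself : u ≡ v → Charged u v
    linked : ∀ x → ¬ Counted E E₁ τ u → T (E₁ u x) → Link v x → Charged u v

  -- A bad but uncounted u sits directly before its target x. The vertex v linked to x differs from
  -- u, since u has no link to x, so it is not directly before x and must be counted.
  charge-to : ∀ u → T (bad u) → ∃[ v ] (Counted E E₁ τ v × Charged u v)
  charge-to u b with counted? E E₁ τ u
  ... | yes counted = u , counted , itself refl
  ... | no ¬counted with bad⁻ u b
  ...   | x , p , ¬link with link-exists u (<-wellFounded u) (uncounted-unique ¬counted p) p
  ...     | v , l with counted? E E₁ τ v
  ...       | yes counted = v , counted , linked x ¬counted p l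
  ...       | no ¬counted′ = ⊥-elim (¬link (subst (λ v → Link v x)
    (position-injective (ℕ.suc-injective
      (trans (sym (adjacent ¬counted′ (proj₁ l))) (adjacent ¬counted p)))) l))

  -- A vertex charged through a link is not bad, so the two kinds of charge never collide. Within
  -- the second kind, v determines its target x, and x determines the vertex directly before it.
  charged-injective : ∀ {u u′ v} → T (bad u) → T (bad u′) → Charged u v → Charged u′ v → u ≡ u′
  charged-injective b b′ (itself refl) (itself refl)     = refl
  charged-injective b b′ (itself refl) (linked _ _ _ l)  = ⊥-elim (link-¬bad l b)
  charged-injective b b′ (linked _ _ _ l) (itself refl)  = ⊥-elim (link-¬bad l b′)
  charged-injective {v = v} b b′ (linked x ¬c p l) (linked x′ ¬c′ p′ l′)
    with link-unique l (E₁⊆E v x′ (proj₁ l′))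
  ... | refl = position-injective (ℕ.suc-injective
    (trans (sym (adjacent ¬c p)) (adjacent ¬c′ p′)))

  bad≤counted : count bad ≤ Vec.count (counted? E E₁ τ) (Vec.allFin n)
  bad≤counted = subst (count bad ≤_) (sym (vec-count (counted? E E₁ τ) id))
    (count-injection bad _ (λ u b → proj₁ (charge-to u b))
      (λ u b → fromCounted (proj₁ (proj₂ (charge-to u b))))
      (λ u b u′ b′ eq → charged-injective b b′ (proj₂ (proj₂ (charge-to u b)))
        (subst (Charged u′) (sym eq) (proj₂ (proj₂ (charge-to u′ b′))))))
    where
    fromCounted : ∀ {v} → Counted E E₁ τ v → T (does (counted? E E₁ τ v))
    fromCounted {v} c with counted? E E₁ τ v
    ... | yes _ = _
    ... | no ¬c = ¬c c

  -- Each arc of the walk advances the position by at least one; a walk of length n + 1 thus refutes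
  -- every sorting.
  walk-bound : ∀ t u → T (walk E t u) → position τ u + t ≤ n
  walk-bound zero    u p = subst (_≤ n) (sym (ℕ.+-identityʳ _)) (toℕ<n (Bijection.to τ u))
  walk-bound (suc t) u p with or-inv false _ p
  ... | inj₂ (v , q) = let (e , p′) = Equivalence.to T-∧ q in
    subst (_≤ n) (sym (ℕ.+-suc _ t))
      (ℕ.≤-trans (ℕ.+-monoˡ-≤ t (sorted u v e)) (walk-bound t v p′))

-- A sorting that counts only bad vertices

module Height {n} (E : Arcs n) where

  -- How many lengths below s are realised by a walk from u.
  height : ℕ → Fin n → ℕ
  height zero    u = 0
  height (suc s) u = (if walk E s u then 1 else 0) + height s u

  height≤ : ∀ s u → height s u ≤ s
  height≤ zero    u = z≤n
  height≤ (suc s) u with walk E s u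
  ... | true  = s≤s (height≤ s u)
  ... | false = ℕ.m≤n⇒m≤1+n (height≤ s u)

  -- Prefixing the arc lengthens each walk from v by one, and the empty walk from u is one length
  -- more.
  height-step : ∀ s {u v} → T (E u v) → height s v < height (suc s) u
  height-step zero    e = s≤s z≤n
  height-step (suc s) {u} {v} e with walk E s v in eq
  ... | false = ℕ.≤-trans (height-step s e) (ℕ.m≤n+m _ (if walk E (suc s) u then 1 else 0))
  ... | true with walk E (suc s) u | or-intro false (λ v → E u v ∧ walk E s v) v
                    (Equivalence.from T-∧ (e , subst T (sym eq) _))
  ...   | true | _ = s≤s (height-step s e)

  -- Without walks of length N, the extra length allowed at u in `height-step` contributes nothing.
  height-decreasing : ∀ N → (∀ u → walk E N u ≡ false) → ∀ {u v} → T (E u v) →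
    height N v < height N u
  height-decreasing N none {u} {v} e =
    subst (λ b → height N v < (if b then 1 else 0) + height N u) (none u) (height-step N e)

lex-< : ∀ {a a′} b {d d′} → a < a′ → d < b → a * b + d < a′ * b + d′
lex-< {a} {a′} b {d} {d′} a<a′ d<b = begin-strict
  a * b + d   <⟨ ℕ.+-monoʳ-< (a * b) d<b ⟩
  a * b + b   ≡⟨ ℕ.+-comm (a * b) b ⟩
  suc a * b   ≤⟨ ℕ.*-monoˡ-≤ b a<a′ ⟩
  a′ * b      ≤⟨ ℕ.m≤m+n _ d′ ⟩
  a′ * b + d′ ∎
  where open ℕ.≤-Reasoning

lex-injective : ∀ {a a′} b {d d′} → d < b → d′ < b →
  a * b + d ≡ a′ * b + d′ → a ≡ a′ × d ≡ d′
lex-injective {a} {a′} b d<b d′<b eq with ℕ.<-cmp a a′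
... | tri< a<a′ _ _ = ⊥-elim (ℕ.<⇒≢ (lex-< b a<a′ d<b) eq)
... | tri> _ _ a′<a = ⊥-elim (ℕ.<⇒≢ (lex-< b a′<a d′<b) (sym eq))
... | tri≈ _ refl _ = refl , ℕ.+-cancelˡ-≡ (a * b) _ _ eq

injective⇒surjective : ∀ {n} (f : Fin n → Fin n) → (∀ {x y} → f x ≡ f y → x ≡ y) →
  ∀ y → ∃[ x ] f x ≡ y
injective⇒surjective {suc n} f inj y with F.any? (λ x → f x F.≟ y)
... | yes hit  = hit
... | no ¬hit = ⊥-elim (ℕ.1+n≰n (F.injective⇒≤ {f = λ x → punchOut (y≢f x)}
    (λ {x} {x′} eq → inj (F.punchOut-injective (y≢f x) (y≢f x′) eq))))
  where
  y≢f : ∀ x → y ≢ f x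
  y≢f x eq = ¬hit (x , sym eq)

module Sorting {n} (E E₁ : Arcs n) (E₁⊆E : E₁ ⊆ E)
  (ht : Fin n → ℕ) (N : ℕ) (ht≤N : ∀ u → ht u ≤ N)
  (ht-< : ∀ {u v} → T (E u v) → ht v < ht u) where
  open Links E E₁ E₁⊆E

  acyclic : Acyclic E
  acyclic v cycle = ℕ.<-irrefl refl (descend cycle)
    where
    descend : ∀ {u v} → TransClosure (E ∋⟨_,_⟩) u v → ht v < ht u
    descend [ e ]    = ht-< e
    descend (e ∷ es) = ℕ.<-trans (descend es) (ht-< e)

  data Chain : Fin n → Fin n → ℕ → Set where
    stop : ∀ {u} → (∀ v → ¬ Link u v) → Chain u u 0
    link : ∀ {u v t d} → Link u v → Chain v t d → Chain u t (suc d)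

  Link⇒E : ∀ {u v} → Link u v → T (E u v)
  Link⇒E {u} {v} l = E₁⊆E u v (proj₁ l)

  chain-from : ∀ u → Acc _<_ (ht u) → ∃[ t ] ∃[ d ] Chain u t d
  chain-from u (acc rec) with F.any? (link? u)
  ... | no ¬l = u , 0 , stop (λ v l → ¬l (v , l))
  ... | yes (v , l) = let (t , d , c) = chain-from v (rec (ht-< (Link⇒E l))) in
    t , suc d , link l c

  chain-functional : ∀ {u t t′ d d′} → Chain u t d → Chain u t′ d′ → t ≡ t′ × d ≡ d′
  chain-functional (stop ¬l)  (stop _)    = refl , refl
  chain-functional (stop ¬l)  (link l _)  = ⊥-elim (¬l _ l)
  chain-functional (link l _) (stop ¬l)   = ⊥-elim (¬l _ l)
  chain-functional (link l c) (link l′ c′) with link-unique l (Link⇒E l′)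
  ... | refl = let (t≡ , d≡) = chain-functional c c′ in t≡ , cong suc d≡

  chain-injective : ∀ {u u′ t d} → Chain u t d → Chain u′ t d → u ≡ u′
  chain-injective (stop _)   (stop _)     = refl
  chain-injective (link l c) (link l′ c′) with chain-injective c c′
  ... | refl = link-injective l l′

  chain-height : ∀ {u t d} → Chain u t d → d + ht t ≤ ht u
  chain-height (stop _)   = ℕ.≤-refl
  chain-height (link l c) = ℕ.≤-trans (s≤s (chain-height c)) (ht-< (Link⇒E l))

  end : Fin n → Fin n
  end u = proj₁ (chain-from u (ℕ-<-wellFounded (ht u)))

  distance : Fin n → ℕ
  distance u = proj₁ (proj₂ (chain-from u (ℕ-<-wellFounded (ht u))))

  chain : ∀ u → Chain u (end u) (distance u)
  chain u = proj₂ (proj₂ (chain-from u (ℕ-<-wellFounded (ht u))))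

  -- The index breaks ties between equal heights, so different chain ends get different values.
  order : Fin n → ℕ
  order t = ht t * n + toℕ t

  -- Chains are kept together, and ordered by their last vertices; along an arc
  -- the key decreases, along a link by exactly one.
  key : Fin n → ℕ
  key u = order (end u) * suc N + distance u

  distance< : ∀ u → distance u < suc N
  distance< u = s≤s (ℕ.≤-trans (ℕ.m+n≤o⇒m≤o _ (chain-height (chain u))) (ht≤N u))

  key-injective : ∀ {u v} → key u ≡ key v → u ≡ v
  key-injective {u} {v} eq =
    let (o≡ , d≡) = lex-injective {order (end u)} {order (end v)} (suc N)
                      (distance< u) (distance< v) eq
        (_ , t≡)  = lex-injective {ht (end u)} {ht (end v)} n
                      (toℕ<n (end u)) (toℕ<n (end v)) o≡
    in chain-injective (chain u)
         (subst₂ (Chain v) (sym (toℕ-injective t≡)) (sym d≡) (chain v))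

  key-link : ∀ {u v} → Link u v → key u ≡ suc (key v)
  key-link {u} {v} l =
    let (t≡ , d≡) = chain-functional (chain u) (link l (chain v)) in
    trans (cong₂ (λ t d → order t * suc N + d) t≡ d≡) (ℕ.+-suc _ _)

  -- If u has a link, the arc is that link. Otherwise u ends its own chain, and the chain of v ends
  -- no higher than v, hence below u.
  key-< : ∀ {u v} → T (E u v) → key v < key u
  key-< {u} {v} e = byCases (F.any? (link? u))
    where
    byCases : Dec (∃[ w ] Link u w) → key v < key u
    byCases (yes (w , l)) = ℕ.≤-reflexive
      (trans (cong (λ w → suc (key w)) (link-unique l e)) (sym (key-link l)))
    byCases (no ¬l) =
      lex-< (suc N) (subst (λ t → order (end v) < order t) (sym end-u) earlier) (distance< v)
      where
      end-u : end u ≡ u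
      end-u = proj₁ (chain-functional (chain u) (stop (λ w l → ¬l (w , l))))

      earlier : order (end v) < order u
      earlier = lex-< n
        (ℕ.≤-<-trans (ℕ.m+n≤o⇒n≤o (distance v) (chain-height (chain v))) (ht-< e))
        (toℕ<n (end v))

  above : Fin n → Fin n → Bool
  above u w = key u <ᵇ key w

  rank : Fin n → ℕ
  rank u = count (above u)

  above⊆remove : ∀ {u v} → key v < key u → ∀ w → T (above u w) → T (remove u (above v) w)
  above⊆remove {u} {v} v<u w p = remove⁺ u (above v) w
    (ℕ.<⇒<ᵇ (ℕ.<-trans v<u (ℕ.<ᵇ⇒< (key u) (key w) p)))
    (λ { refl → ℕ.<-irrefl refl (ℕ.<ᵇ⇒< (key u) (key u) p) })

  rank-< : ∀ {u v} → key v < key u → rank u < rank v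
  rank-< {u} {v} v<u = subst (rank u <_) (sym (count-remove u (above v) (ℕ.<⇒<ᵇ v<u)))
    (s≤s (count-mono (above u) (remove u (above v)) (above⊆remove v<u)))

  -- The keys differ by one and keys are injective, so u is the only vertex above v that is not
  -- above u.
  rank-link : ∀ {u v} → Link u v → rank v ≡ suc (rank u)
  rank-link {u} {v} l = trans (count-remove u (above v) (ℕ.<⇒<ᵇ v<u))
    (cong suc (ℕ.≤-antisym (count-mono (remove u (above v)) (above u) remove⊆above)
                           (count-mono (above u) (remove u (above v)) (above⊆remove v<u))))
    where
    v<u = ℕ.≤-reflexive (sym (key-link l))

    remove⊆above : ∀ w → T (remove u (above v) w) → T (above u w)
    remove⊆above w p = let (q , w≢u) = remove⁻ u (above v) w p in
      ℕ.<⇒<ᵇ (ℕ.≤∧≢⇒< (subst (_≤ key w) (sym (key-link l)) (ℕ.<ᵇ⇒< (key v) (key w) q))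
                      (λ same → w≢u (sym (key-injective same))))

  rank<n : ∀ u → rank u < n
  rank<n u = subst (rank u <_) (trans (sym (count-remove u (λ _ → true) _)) (count-all n))
    (s≤s (count-mono (above u) (remove u (λ _ → true))
      (λ w p → remove⁺ u (λ _ → true) w _
        (λ { refl → ℕ.<-irrefl refl (ℕ.<ᵇ⇒< (key u) (key u) p) }))))

  place : Fin n → Fin n
  place u = F.fromℕ< (rank<n u)

  toℕ-place : ∀ u → toℕ (place u) ≡ rank u
  toℕ-place u = F.toℕ-fromℕ< (rank<n u)

  place-injective : ∀ {u v} → place u ≡ place v → u ≡ v
  place-injective {u} {v} eq with ℕ.<-cmp (key u) (key v)
  ... | tri≈ _ same _ = key-injective same
  ... | tri< u<v _ _ = ⊥-elim (ℕ.<⇒≢ (rank-< u<v) (sym ranks))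
    where ranks = trans (sym (toℕ-place u)) (trans (cong toℕ eq) (toℕ-place v))
  ... | tri> _ _ v<u = ⊥-elim (ℕ.<⇒≢ (rank-< v<u) ranks)
    where ranks = trans (sym (toℕ-place u)) (trans (cong toℕ eq) (toℕ-place v))

  sorting : Fin n ⤖ Fin n
  sorting = mk⤖ (place-injective , λ y →
    let (x , eq) = injective⇒surjective place place-injective y in x , λ { refl → eq })

  sorting-sorted : IsTopologicalSorting E sorting
  sorting-sorted u v e = s≤s (subst₂ _<_ (sym (toℕ-place u)) (sym (toℕ-place v)) (rank-< (key-< e)))

  position-link : ∀ {u v} → Link u v → position sorting v ≡ suc (position sorting u)
  position-link {u} {v} l = cong suc
    (trans (toℕ-place v) (trans (rank-link l) (cong suc (sym (toℕ-place u)))))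

  -- A link leads to the next position and is the only arc of v, which excludes both reasons for
  -- counting v; so the arc in question is no link.
  counted⇒bad : ∀ v → Counted E E₁ sorting v → T (bad v)
  counted⇒bad v (u , p , why) with link? v u
  ... | no ¬l = bad⁺ v u p ¬l
  ... | yes l = ⊥-elim (impossible why)
    where
    impossible : ¬ (1 < position sorting u ∸ position sorting v ⊎ ∃[ w ] T ((E ∖ E₁) v w))
    impossible (inj₁ far) = ℕ.<-irrefl refl (subst (1 <_)
      (trans (cong (_∸ position sorting v) (position-link l))
             (ℕ.m+n∸n≡m 1 (position sorting v))) far)
    impossible (inj₂ (w , q)) with Equivalence.to T-∧ q
    ... | e , ¬e₁ with link-unique l e
    ...   | refl = T-not⁻ ¬e₁ p

  counted≤bad : Vec.count (counted? E E₁ sorting) (Vec.allFin n) ≤ count bad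
  counted≤bad = subst (_≤ count bad) (sym (vec-count (counted? E E₁ sorting) id))
    (count-mono _ bad (λ v p → counted⇒bad v (toCounted v p)))
    where
    toCounted : ∀ v → T (does (counted? E E₁ sorting v)) → Counted E E₁ sorting v
    toCounted v p with counted? E E₁ sorting v
    ... | yes c = c

-- The decision procedure

concatMap-entries : ∀ {A : Set} {m} (e e₁ : A → Bool) (f : Fin m → A) z →
  concatMap (λ v → e v ∷ e₁ v ∷ []) (tabulate f) ++ z ≡ entries id (e ∘ f) (e₁ ∘ f) z
concatMap-entries {m = zero}  e e₁ f z = refl
concatMap-entries {m = suc m} e e₁ f z =
  cong (λ bs → _ ∷ _ ∷ bs) (concatMap-entries e e₁ (f ∘ suc) z)

concatMap-matrix : ∀ {n m} (E E₁ : Arcs n) (f : Fin m → Fin n) →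
  concatMap (λ u → concatMap (λ v → E u v ∷ E₁ u v ∷ []) (allFin n)) (tabulate f)
  ≡ matrix id (E ∘ f) (E₁ ∘ f) []
concatMap-matrix {m = zero}  E E₁ f = refl
concatMap-matrix {n} {suc m} E E₁ f =
  trans (cong (concatMap (λ v → E (f zero) v ∷ E₁ (f zero) v ∷ []) (allFin n) ++_)
              (concatMap-matrix E E₁ (f ∘ suc)))
        (concatMap-entries (E (f zero)) (E₁ (f zero)) id _)

encode≡header : ∀ I → let open MILInstance I in encodeMIL I ≡ header n K (matrix id E E₁ [])
encode≡header I = cong (header n K) (concatMap-matrix E E₁ id)
  where open MILInstance I

valid⇒⊆ : ∀ {n} {E E₁ : Arcs n} → (∀ u → Valid (E u) (E₁ u)) → E₁ ⊆ E
valid⇒⊆ {E = E} {E₁} valid u v p with E u v | E₁ u v | valid u v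
... | true | true | _ = _

⊆⇒valid : ∀ {n} {E E₁ : Arcs n} → E₁ ⊆ E → ∀ u → Valid (E u) (E₁ u)
⊆⇒valid {E = E} {E₁} E₁⊆E u v with E u v | E₁ u v | E₁⊆E u v
... | true  | _     | _ = refl
... | false | false | _ = refl
... | false | true  | p = ⊥-elim (p _)

-- The exact time is k + 18 + 22n + 20n² + 5n³ with K = k + 1; as k is at most the input length, it
-- raises the linear coefficient to 23.
bound : Polynomial
bound = 18 ∷ 23 ∷ 20 ∷ 5 ∷ []

eval-mono : ∀ p {x y} → x ≤ y → eval p x ≤ eval p y
eval-mono []      x≤y = z≤n
eval-mono (a ∷ p) x≤y = ℕ.+-monoʳ-≤ a (ℕ.*-mono-≤ x≤y (eval-mono p x≤y))

totalTime≡ : ∀ n k → totalTime n k ≡ k + eval (18 ∷ 22 ∷ 20 ∷ 5 ∷ []) n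
totalTime≡ n k = expand n k
  where
  expand : ∀ n k →
    let row   = 1 + (n * 2 + (1 + (n + 1)))
        round = (n * row + (1 + (n * (n * 2) + (1 + (n + 1))))) + (n + 1)
    in (1 + (n + (1 + (1 + (k + 1))))) +
       ((n + 1) + (round + (round + ((n + 1) + (round + n * round)))))
       ≡ k + (18 + n * (22 + n * (20 + n * (5 + n * 0))))
  expand = solve-∀

totalTime≤bound : ∀ n k N → n ≤ N → k ≤ N → totalTime n k ≤ eval bound N
totalTime≤bound n k N n≤N k≤N = begin
  totalTime n k ≡⟨ totalTime≡ n k ⟩
  k + eval p n  ≤⟨ ℕ.+-mono-≤ k≤N (eval-mono p n≤N) ⟩
  N + eval p N  ≡⟨ regroup N ⟩
  eval bound N  ∎
  where
  p = 18 ∷ 22 ∷ 20 ∷ 5 ∷ []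
  open ℕ.≤-Reasoning
  regroup : ∀ N → N + (18 + N * (22 + N * (20 + N * (5 + N * 0))))
                  ≡ 18 + N * (23 + N * (20 + N * (5 + N * 0)))
  regroup = solve-∀

2+≤bound : ∀ N → 2 + N ≤ eval bound N
2+≤bound N = ℕ.+-mono-≤ {2} {18} (s≤s (s≤s z≤n)) (ℕ.m≤m*n N (eval (23 ∷ 20 ∷ 5 ∷ []) N))

module _ (n k : ℕ) (bs : List Bool) where

  private
    w = header n (suc k) bs

    length-w : length w ≡ n + suc (suc k + suc (length bs))
    length-w = trans (length-++ (replicate n true)) (cong₂ _+_ (length-replicate n)
      (cong suc (trans (length-++ (replicate (suc k) true))
        (cong (_+ suc (length bs)) (length-replicate (suc k))))))

  n≤length : n ≤ length w
  n≤length = subst (n ≤_) (sym length-w) (ℕ.m≤m+n n _)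

  k≤length : k ≤ length w
  k≤length = subst (k ≤_) (sym length-w) (ℕ.m≤n⇒m≤o+n n
    (ℕ.m≤n⇒m≤1+n (ℕ.m≤n⇒m≤1+n (ℕ.m≤m+n k _))))

  withinBound : ∀ {b} → onInput w ⇓[ totalTime n k ] b → onInput w ⇓[ eval bound (length w) ] b
  withinBound = halts-≤ (totalTime≤bound n k (length w) n≤length k≤length)

Sorts : ∀ {n} → Arcs n → Arcs n → ℕ → Set
Sorts {n} E E₁ K = Σ[ τ ∈ Fin n ⤖ Fin n ] (IsTopologicalSorting E τ ×
  Vec.count (counted? E E₁ τ) (Vec.allFin n) ≤ K)

accepted : ∀ n K (E E₁ : Arcs n) → 0 < K → K ≤ n → E₁ ⊆ E → Sorts E E₁ K →
  let w = header n K (matrix id E E₁ []) in onInput w ⇓[ eval bound (length w) ] true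
accepted n (suc k) E E₁ _ K≤n E₁⊆E (τ , sorted , few) =
  -- n - K cells lie to the left of the counter head. The number of vertices is generalised in `go′`
  -- so that its equation can be matched.
  go′ (n ∸ suc k) (trans (ℕ.+-suc k _) (ℕ.m+[n∸m]≡n K≤n)) E E₁ E₁⊆E τ sorted few
  where
  go′ : ∀ i {n} → k + suc i ≡ n → (E E₁ : Arcs n) → E₁ ⊆ E → ∀ τ → IsTopologicalSorting E τ →
    Vec.count (counted? E E₁ τ) (Vec.allFin n) ≤ suc k →
    let w = header n (suc k) (matrix id E E₁ []) in onInput w ⇓[ eval bound (length w) ] true
  go′ i refl E E₁ E₁⊆E τ sorted few with decide-run k i E E₁ (⊆⇒valid E₁⊆E)
  ... | inj₁ (h , _) = withinBound _ k _ h
  ... | inj₂ (_ , inj₁ many) = ⊥-elim (ℕ.<⇒≱ many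
    (ℕ.≤-trans (LowerBound.bad≤counted E E₁ E₁⊆E τ sorted) few))
  ... | inj₂ (_ , inj₂ (u , walks-on)) = ⊥-elim (ℕ.<⇒≱ ℕ.≤-refl
    (ℕ.m+n≤o⇒n≤o (position τ u)
      (LowerBound.walk-bound E E₁ E₁⊆E τ sorted (suc (k + suc i)) u (subst T (sym walks-on) _))))

language⇒accepted : ∀ {w} → language 5th-MIL-MIZ w → onInput w ⇓[ eval bound (length w) ] true
language⇒accepted (I , refl , yes-I) =
  subst (λ w → onInput w ⇓[ eval bound (length w) ] true) (sym (encode≡header I))
    (accepted n K E E₁ K>0 K≤n E₁⊆E yes-I)
  where open MILInstance I

-- The length t without walks bounds the heights; these give both the acyclicity of the rebuilt
-- instance and its sorting.
accepted⇒language : ∀ k i (E E₁ : Arcs (k + suc i)) → (∀ u → Valid (E u) (E₁ u)) →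
  count (Spec.bad E E₁) ≤ suc k → ∃[ t ] (∀ u → walk E t u ≡ false) →
  language 5th-MIL-MIZ (header (k + suc i) (suc k) (matrix id E E₁ []))
accepted⇒language k i E E₁ valid few (t , none) =
  instance′ , encode≡header instance′ , sorting , sorting-sorted , ℕ.≤-trans counted≤bad few
  where
  open Height E
  open Sorting E E₁ (valid⇒⊆ valid) (height t) t (height≤ t) (height-decreasing t none)

  instance′ : MILInstance
  instance′ = record
    { n = k + suc i ; E = E ; acyclic = acyclic ; E₁ = E₁ ; E₁⊆E = valid⇒⊆ valid
    ; K = suc k ; K>0 = s≤s z≤n
    ; K≤n = subst (suc k ≤_) (sym (ℕ.+-suc k i)) (s≤s (ℕ.m≤m+n k i))
    }

-- The rejecting side carries no proof of non-membership: a member would be accepted by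
-- `language⇒accepted`, and a run cannot end in both verdicts after the same number of steps.
decide : ∀ w → (onInput w ⇓[ eval bound (length w) ] true × language 5th-MIL-MIZ w)
             ⊎ onInput w ⇓[ eval bound (length w) ] false
decide w with header-parse w
... | inj₂ h = inj₂ (halts-≤ (2+≤bound (length w)) h)
... | inj₁ (k , i , bs , refl) with header-run k i bs
...   | g , load with matrix-parse (k + suc i) bs {g} {counter i (suc k)}
...     | inj₂ h = inj₂ (withinBound n k bs (halts-≤ time
            (load thenHalts setup-run n i k g bs thenHalts h)))
  where
  n = k + suc i

  time : headerTime n k + (setupTime n + (n * rowTime n + 1)) ≤ totalTime n k
  time = ℕ.+-monoʳ-≤ (headerTime n k) (ℕ.+-monoʳ-≤ (setupTime n)
    (ℕ.m≤n⇒m≤n+o _ (ℕ.m≤n⇒m≤n+o (n + 1) (ℕ.+-monoʳ-≤ (n * rowTime n) (s≤s z≤n)))))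
...     | inj₁ (E , E₁ , valid , refl) with decide-run k i E E₁ valid
...       | inj₂ (h , _) = inj₂ (withinBound (k + suc i) k bs h)
...       | inj₁ (h , few , none) =
  inj₁ (withinBound (k + suc i) k bs h , accepted⇒language k i E E₁ valid few none)

theorem7p2 : SolvableInPolynomialTime 5th-MIL-MIZ
theorem7p2 = machine , bound , verdict
  where
  verdict : DecidesInTime machine (language 5th-MIL-MIZ) (eval bound)
  verdict w with decide w
  ... | inj₁ (h , w∈L) = inj₁ (halts⇒accepts h , w∈L)
  ... | inj₂ h = inj₂ (halts⇒rejects h , λ w∈L →
    case trans (sym (halted h)) (halted (language⇒accepted w∈L)) of λ ())
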